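{- Let $q$ be an odd prime power with $q\equiv 2\pmod 3$, let $\mathbb{F}_q$ be the finite field with $q$ elements, of characteristic $p$, and let $a_1,a_2,\dots,a_{q-1}$ be all the nonzero elements of $\mathbb{F}_q$. Let $$T_q=\left[\frac{1}{a_i^2-a_ia_j+a_j^2}\right]_{1\le i,j\le q-1},$$ a $(q-1)\times(q-1)$ matrix over $\mathbb{F}_q$. Then $$\det T_q=(-1)^{\frac{q+1}{2}}\,2^{\frac{q-2}{3}}\in\mathbb{F}_p.$$
   Context: The elements $a_1,\dots,a_{q-1}$ are an enumeration, without repetition, of $\mathbb{F}_q^{\times}=\mathbb{F}_q\setminus\{0\}$. The same enumeration indexes the rows and columns of $T_q$. The prime field $\mathbb{F}_p$ is regarded as a subfield of $\mathbb{F}_q$, and integers are interpreted as their images in $\mathbb{F}_p$. -}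

module Defs where

open import Algebra.Apartness.Bundles using (HeytingField; HeytingCommutativeRing)
open import Algebra.Bundles using (CommutativeRing)
open import Data.Fin using (Fin; zero; suc; toℕ)
import Data.Fin.Properties as Fin
open import Data.Integer using (ℤ; +_; -[1+_])
open import Data.Nat as ℕ using (ℕ; zero; suc; NonZero; _<_; _∸_)
open import Data.Nat.Divisibility using (_∣_)
open import Data.Nat.Primality using (Prime)
open import Data.Product using (∃-syntax; _×_; _,_; proj₁)
open import Data.Vec.Functional using (Vector; removeAt)
open import Function.Bundles using (Bijection; Inverse; _⇔_)
open import Function.Definitions using (Injective)
open import Function.Properties.Bijection using (Bijection⇒Inverse)
open import Function.Properties.Inverse using (Inverse⇒Injection) renaming (sym to ↔-sym)
open import Level as Level using (_⊔_)
open import Relation.Binary.Definitions using (Decidable)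
open import Relation.Binary.PropositionalEquality using (_≡_) renaming (setoid to ≡-setoid)
open import Relation.Nullary using (¬_; Dec; yes; no; contradiction)
open import Relation.Nullary.Decidable using (via-injection)

IsPrimePower : ℕ → Set
IsPrimePower q = ∃[ p ] ∃[ k ] Prime p × NonZero k × q ≡ p ℕ.^ k

module _ {c ℓ} (R : CommutativeRing c ℓ) where
  open CommutativeRing R hiding (zero)
  open import Algebra.Properties.Semiring.Exp semiring using (_^_)
  open import Algebra.Properties.Semiring.Mult semiring using () renaming (_×_ to _·_)
  open import Algebra.Properties.Semiring.Sum semiring using (sum)

  Matrix : ℕ → ℕ → Set c
  Matrix m n = Vector (Vector Carrier n) m

  -- Laplace expansion along the first row.
  determinant : ∀ {n} → Matrix n n → Carrier
  determinant {zero}  M = 1#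
  determinant {suc n} M =
    sum λ j → (- 1#) ^ toℕ j * M zero j * determinant (λ i → removeAt (M (suc i)) j)

  integerImage : ℤ → Carrier
  integerImage (+ n)    = n · 1#
  integerImage -[1+ n ] = - (suc n · 1#)

  -- p = 0 is the usual characteristic zero, since 0 ∣ n only for n = 0.
  HasCharacteristic : ℕ → Set ℓ
  HasCharacteristic p = ∀ n → (n · 1# ≈ 0#) ⇔ (p ∣ n)

  -- For p the (positive) characteristic of a field, these are the elements
  -- of its prime field.
  InPrimeField : ℕ → Carrier → Set ℓ
  InPrimeField p x = ∃[ k ] k < p × x ≈ k · 1#

-- On a finite Heyting field x # y is equivalent to ¬ (x ≈ y): ≈ is decidable,
-- and so is invertibility, by search.
record FiniteField c ℓ₁ ℓ₂ (q : ℕ) : Set (Level.suc (c ⊔ ℓ₁ ⊔ ℓ₂)) where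
  field
    heytingField : HeytingField c ℓ₁ ℓ₂

  open HeytingField heytingField public
  open HeytingCommutativeRing heytingCommutativeRing public using (commutativeRing)
  open CommutativeRing commutativeRing using () renaming (setoid to ≈-setoid)

  field
    enumeration : Bijection (≡-setoid (Fin q)) ≈-setoid

  private
    index = Bijection⇒Inverse enumeration

  open Inverse index using () renaming (to to element)

  infix 4 _≟_
  _≟_ : Decidable _≈_
  _≟_ = via-injection (Inverse⇒Injection (↔-sym index)) Fin._≟_

  hasInverse? : ∀ x → Dec (∃[ k ] x * element k ≈ 1#)
  hasInverse? x = Fin.any? (λ k → x * element k ≟ 1#)

  -- Total inversion, with x ⁻¹ = 0 for x not invertible.
  infix 9 _⁻¹
  _⁻¹ : Carrier → Carrier
  x ⁻¹ with hasInverse? x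
  ... | yes (k , _) = element k
  ... | no  _       = 0#

  ⁻¹-inverseʳ : ∀ {x} → ¬ (x ≈ 0#) → x * x ⁻¹ ≈ 1#
  ⁻¹-inverseʳ {x} x≉0 with hasInverse? x
  ... | yes (_ , x*y≈1) = x*y≈1
  ... | no  ∄y          = contradiction (proj₁ (tight x 0#) x¬#0) x≉0
    where
    open CommutativeRing commutativeRing using (ring)
    open import Algebra.Properties.Ring ring using (-0#≈0#)
    x-0≈x : x - 0# ≈ x
    x-0≈x = trans (+-congˡ -0#≈0#) (+-identityʳ x)
    x¬#0 : ¬ (x # 0#)
    x¬#0 x#0 with #⇒invertible x#0
    ... | y , _ , [x-0]*y≈1 = ∄y (Inverse.from index y ,
      trans (*-cong (sym x-0≈x) (Inverse.strictlyInverseˡ index y)) [x-0]*y≈1)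

  record EnumeratesNonzero {n} (a : Vector Carrier n) : Set (c ⊔ ℓ₁ ⊔ ℓ₂) where
    field
      nonzero    : ∀ i → a i # 0#
      injective  : Injective _≡_ _≈_ a
      exhaustive : ∀ x → x # 0# → ∃[ i ] a i ≈ x

  open import Algebra.Properties.Semiring.Exp (CommutativeRing.semiring commutativeRing) using (_^_)

  -- For q odd with q ≡ 2 (mod 3) and nonzero a i, a j the inverted element is
  -- nonzero, so the value 0# ⁻¹ plays no role.
  T : Vector Carrier (q ∸ 1) → Matrix commutativeRing (q ∸ 1) (q ∸ 1)
  T a i j = (a i ^ 2 - a i * a j + a j ^ 2) ⁻¹

{-# OPTIONS --safe #-}

-- Write N = q - 1 = 3n + 1 and h m = Σ t ^ m / (t² - t + 1), t ranging over the
-- nonzero elements. Substituting t = a_i s shows that T V = D V Λ for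
-- V = [a_i ^ 3r] (1 ≤ r ≤ N), D = diag (a_i ⁻²) and Λ = diag (h (3r)).
-- V is invertible because the power sums s m = Σ t ^ m vanish unless N ∣ m,
-- and det D = 1, so det T = Π h (3r). The h m satisfy
-- h (m + 2) - h (m + 1) + h m = s m, hence h (m + 3) + h m = s (m + 1) + s m,
-- which gives h (3r) = (-1)^r (x + 1) for 1 ≤ r ≤ n and h (3r) = (-1)^r x for
-- n < r ≤ N, where x = h 0. As 2 ≡ 3(n + 1) and 1 ≡ 3(2n + 1) modulo N, the
-- recurrence at m = 0 reads 3x = -1, so x + 1 = -2x, and x ^ N = 1.

module Submission where

open import Algebra.Bundles using (CommutativeRing)
open import Algebra.Solver.Ring.AlmostCommutativeRing using (fromCommutativeRing; _-Raw-AlmostCommutative⟶_)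
import Algebra.Solver.Ring
open import Data.Fin using (Fin; zero; suc; toℕ; punchIn; inject≤)
import Data.Fin.Properties as Fin
open import Data.Fin.Permutation using (permutation; _⟨$⟩ʳ_)
open import Data.Integer as ℤ using (ℤ; +_; -[1+_]; -1ℤ)
import Data.Integer.Properties as ℤ
open import Data.Maybe using (Maybe; map)
open import Data.Nat as ℕ using (ℕ; zero; suc; _∸_; _/_; _%_; s≤s; z≤n)
import Data.Nat.DivMod as ℕ
open import Data.Nat.Divisibility
  using (_∣_; divides; ∣-refl; _∣0; ∣m⇒∣m*n; n∣m*n; ∣m+n∣m⇒∣n; >⇒∤; 0∣⇒≡0; m%n≡0⇒n∣m)
import Data.Nat.Properties as ℕ
open import Data.Nat.Solver using (module +-*-Solver)
open import Data.Product using (_×_; _,_; proj₁; proj₂; ∃-syntax)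
open import Data.Vec.Functional using (Vector; removeAt)
open import Function using (_∘_; Bijection; Equivalence)
open import Function.Definitions using (Injective)
open import Level using (_⊔_)
open import Relation.Binary.Consequences using (dec⇒weaklyDec)
open import Relation.Binary.PropositionalEquality as ≡ using (_≡_; _≢_)
open import Relation.Nullary using (¬_; yes; no; contradiction)
import Algebra.Properties.CommutativeSemigroup ℕ.+-commutativeSemigroup as ℕ+
open import Defs

open +-*-Solver using ()
  renaming (solve to ℕsolve; _:+_ to _⊕_; _:*_ to _⊛_; _:=_ to _⊜_; con to ℕcon)

-- Up to the row factor a_i ⁻², the entry of T at (i, j) depends only on a_j / a_i. So T is
-- essentially a group matrix of the multiplicative group, and the characters t ^ m diagonalise it
-- with eigenvalues h m. The characters are listed with exponents 3r for two reasons. As N = 3n + 1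
-- is prime to 3, the 3r meet every residue modulo N once; and in this order the three-step
-- recurrence leads from each eigenvalue to the next. Such a step only changes the sign, except at m
-- = 0 and at m = 3n, where m + 1 = N: there a power sum equals -1. The final sign has two sources.
-- N is even, so n is odd and (-2)^n = -2^n; and the signs (-1)^r for 1 ≤ r ≤ N multiply to
-- (-1)^(N/2). Together they give the exponent N/2 + 1 = (q + 1)/2. Since `determinant` is a Laplace
-- expansion, its multiplicativity is derived from alternating multilinear functions of the rows,
-- and no sum over permutations appears.

-- Integers in a commutative ring.

module RingLemmas {c ℓ} (R : CommutativeRing c ℓ) where
  open CommutativeRing R hiding (zero)
  open import Algebra.Properties.AbelianGroup +-abelianGroup using (⁻¹-∙-comm; ε⁻¹≈ε; ⁻¹-involutive)
  open import Algebra.Properties.Ring ring using (-‿distribˡ-*; -‿distribʳ-*)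
  open import Algebra.Properties.Semiring.Mult semiring using (×-homo-+; ×1-homo-*) renaming (_×_ to _·_)
  open import Algebra.Properties.Semiring.Mult.TCOptimised semiring using (×ᵤ≈×) renaming (_×_ to _·′_)
  open import Relation.Binary.Reasoning.Setoid setoid

  image : ℤ → Carrier
  image = integerImage R

  image-neg : ∀ i → image (ℤ.- i) ≈ - image i
  image-neg (+ zero)  = sym ε⁻¹≈ε
  image-neg (+ suc n) = refl
  image-neg -[1+ n ]  = sym (⁻¹-involutive _)

  image-⊖ : ∀ m n → image (m ℤ.⊖ n) ≈ m · 1# - n · 1#
  image-⊖ zero    zero    = sym (-‿inverseʳ 0#)
  image-⊖ zero    (suc n) = sym (+-identityˡ _)
  image-⊖ (suc m) zero    = sym (trans (+-congˡ ε⁻¹≈ε) (+-identityʳ _))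
  image-⊖ (suc m) (suc n) = begin
    image (suc m ℤ.⊖ suc n)                ≡⟨ ≡.cong image (ℤ.[1+m]⊖[1+n]≡m⊖n m n) ⟩
    image (m ℤ.⊖ n)                        ≈⟨ image-⊖ m n ⟩
    m · 1# - n · 1#                    ≈⟨ +-congʳ (+-identityʳ _) ⟨
    m · 1# + 0# - n · 1#               ≈⟨ +-congʳ (+-congˡ (-‿inverseʳ 1#)) ⟨
    m · 1# + (1# - 1#) - n · 1#        ≈⟨ +-congʳ (+-assoc _ _ _) ⟨
    m · 1# + 1# - 1# - n · 1#          ≈⟨ +-assoc _ _ _ ⟩
    m · 1# + 1# + (- 1# - n · 1#)      ≈⟨ +-cong (+-comm _ _) (⁻¹-∙-comm _ _) ⟩
    1# + m · 1# - (1# + n · 1#)        ∎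

  image-+ : ∀ i j → image (i ℤ.+ j) ≈ image i + image j
  image-+ (+ m)    (+ n)    = ×-homo-+ 1# m n
  image-+ (+ m)    -[1+ n ] = image-⊖ m (suc n)
  image-+ -[1+ m ] (+ n)    = trans (image-⊖ n (suc m)) (+-comm _ _)
  image-+ -[1+ m ] -[1+ n ] = begin
    - (suc (suc (m ℕ.+ n)) · 1#)         ≡⟨ ≡.cong (λ k → - (suc k · 1#)) (ℕ.+-suc m n) ⟨
    - ((suc m ℕ.+ suc n) · 1#)           ≈⟨ -‿cong (×-homo-+ 1# (suc m) (suc n)) ⟩
    - (suc m · 1# + suc n · 1#)          ≈⟨ ⁻¹-∙-comm _ _ ⟨
    - (suc m · 1#) - suc n · 1#          ∎

  image-*⁺ : ∀ m j → image (+ m ℤ.* j) ≈ image (+ m) * image j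
  image-*⁺ m (+ n)    = begin
    image (+ m ℤ.* + n)   ≡⟨ ≡.cong image (ℤ.pos-* m n) ⟨
    (m ℕ.* n) · 1#    ≈⟨ ×1-homo-* m n ⟩
    m · 1# * (n · 1#) ∎
  image-*⁺ m -[1+ n ] = begin
    image (+ m ℤ.* ℤ.- (+ suc n))     ≡⟨ ≡.cong image (ℤ.neg-distribʳ-* (+ m) (+ suc n)) ⟨
    image (ℤ.- (+ m ℤ.* + suc n))     ≈⟨ image-neg (+ m ℤ.* + suc n) ⟩
    - image (+ m ℤ.* + suc n)         ≈⟨ -‿cong (image-*⁺ m (+ suc n)) ⟩
    - (m · 1# * (suc n · 1#))     ≈⟨ -‿distribʳ-* _ _ ⟩
    m · 1# * - (suc n · 1#)       ∎

  image-* : ∀ i j → image (i ℤ.* j) ≈ image i * image j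
  image-* (+ m)    j = image-*⁺ m j
  image-* -[1+ m ] j = begin
    image (ℤ.- (+ suc m) ℤ.* j)       ≡⟨ ≡.cong image (ℤ.neg-distribˡ-* (+ suc m) j) ⟨
    image (ℤ.- (+ suc m ℤ.* j))       ≈⟨ image-neg (+ suc m ℤ.* j) ⟩
    - image (+ suc m ℤ.* j)           ≈⟨ -‿cong (image-*⁺ (suc m) j) ⟩
    - (suc m · 1# * image j)        ≈⟨ -‿distribˡ-* _ _ ⟩
    - (suc m · 1#) * image j        ∎

  ⟦_⟧ : ℤ → Carrier
  ⟦ + n ⟧      = n ·′ 1#
  ⟦ -[1+ n ] ⟧ = - (suc n ·′ 1#)

  ⟦⟧≈image : ∀ i → ⟦ i ⟧ ≈ image i
  ⟦⟧≈image (+ n)    = sym (×ᵤ≈× n 1#)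
  ⟦⟧≈image -[1+ n ] = -‿cong (sym (×ᵤ≈× (suc n) 1#))

  -- Integer coefficients, rather than coefficients in R, have decidable
  -- equality, so that the solver can cancel; ⟦_⟧ differs from integerImage
  -- in that ⟦ + 1 ⟧ is 1# by definition.
  coefficients : ℤ.+-*-rawRing -Raw-AlmostCommutative⟶ fromCommutativeRing R
  coefficients = record
    { ⟦_⟧    = ⟦_⟧
    ; +-homo = λ i j → trans (⟦⟧≈image (i ℤ.+ j))
        (trans (image-+ i j) (sym (+-cong (⟦⟧≈image i) (⟦⟧≈image j))))
    ; *-homo = λ i j → trans (⟦⟧≈image (i ℤ.* j))
        (trans (image-* i j) (sym (*-cong (⟦⟧≈image i) (⟦⟧≈image j))))
    ; -‿homo = λ i → trans (⟦⟧≈image (ℤ.- i))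
        (trans (image-neg i) (-‿cong (sym (⟦⟧≈image i))))
    ; 0-homo = refl
    ; 1-homo = refl
    }

  coefficient-≟ : ∀ i j → Maybe (⟦ i ⟧ ≈ ⟦ j ⟧)
  coefficient-≟ i j = map (reflexive ∘ ≡.cong ⟦_⟧) (dec⇒weaklyDec ℤ._≟_ i j)

  open Algebra.Solver.Ring ℤ.+-*-rawRing (fromCommutativeRing R) coefficients coefficient-≟
    public using (solve; _:=_; _:+_; _:*_; _:-_; :-_; con)

-- Multiplicativity of the determinant.

module DeterminantLemmas {c ℓ} (R : CommutativeRing c ℓ) where
  open import Data.Vec.Functional using (_∷_; tail)
  open CommutativeRing R hiding (zero)
  open import Algebra.Properties.AbelianGroup +-abelianGroup using (inverseˡ-unique)
  open import Algebra.Properties.Semiring.Exp semiring using (_^_)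
  open import Algebra.Properties.Semiring.Sum semiring
  open import Algebra.Properties.CommutativeMonoid.Sum *-commutativeMonoid using () renaming (sum to prod)
  open import Relation.Binary.Reasoning.Setoid setoid
  open RingLemmas R

  private
    det : ∀ {n} → Matrix R n n → Carrier
    det = determinant R

    sgn : ∀ {n} → Fin n → Carrier
    sgn j = (- 1#) ^ toℕ j

    variable
      m n : ℕ

  sum-zero : (f : Vector Carrier n) → (∀ j → f j ≈ 0#) → sum f ≈ 0#
  sum-zero {n} f f≈0 = trans (sum-cong-≋ f≈0) (sum-replicate-zero n)

  sum-linear : ∀ s (f g h : Vector Carrier n) →
    (∀ j → f j ≈ g j + s * h j) → sum f ≈ sum g + s * sum h
  sum-linear s f g h f≈g+sh = begin
    sum f                           ≈⟨ sum-cong-≋ f≈g+sh ⟩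
    sum (λ j → g j + s * h j)       ≈⟨ ∑-distrib-+ g (λ j → s * h j) ⟩
    sum g + sum (λ j → s * h j)     ≈⟨ +-congˡ (*-distribˡ-sum s h) ⟨
    sum g + s * sum h               ∎

  -- Matrices are rectangular so that fixing the first row stays within the notion, which makes
  -- induction on the number of rows possible. Only adjacent equal rows are required to give zero,
  -- since this is what Laplace expansion yields directly.
  record IsMultilinearAlternating {m n} (F : Matrix R m n → Carrier) : Set (c ⊔ ℓ) where
    field
      cong : ∀ {A B} → (∀ i j → A i j ≈ B i j) → F A ≈ F B
      linear : ∀ i s {A B C} →
        (∀ j → A i j ≈ B i j + s * C i j) →
        (∀ k → k ≢ i → ∀ j → A k j ≈ B k j) →
        (∀ k → k ≢ i → ∀ j → A k j ≈ C k j) →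
        F A ≈ F B + s * F C
      alternating : ∀ i k → toℕ k ≡ suc (toℕ i) →
        ∀ {A} → (∀ j → A i j ≈ A k j) → F A ≈ 0#

  open IsMultilinearAlternating

  ∷-isMultilinearAlternating : ∀ {F : Matrix R (suc m) n → Carrier} →
    IsMultilinearAlternating F → ∀ v → IsMultilinearAlternating (F ∘ (v ∷_))
  ∷-isMultilinearAlternating F-ma v .cong A≈B =
    F-ma .cong λ { zero j → refl ; (suc i) j → A≈B i j }
  ∷-isMultilinearAlternating F-ma v .linear i s A≈B+sC A≈B A≈C =
    F-ma .linear (suc i) s A≈B+sC
      (λ { zero _ j → refl ; (suc k) k≢i j → A≈B k (k≢i ∘ ≡.cong suc) j })
      (λ { zero _ j → refl ; (suc k) k≢i j → A≈C k (k≢i ∘ ≡.cong suc) j })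
  ∷-isMultilinearAlternating F-ma v .alternating i k k≡1+i =
    F-ma .alternating (suc i) (suc k) (≡.cong suc k≡1+i)

  module _ {F : Matrix R (suc m) n → Carrier} (F-ma : IsMultilinearAlternating F) where

    linear₀ : ∀ s {u v w} → (∀ j → u j ≈ v j + s * w j) → ∀ A →
      F (u ∷ A) ≈ F (v ∷ A) + s * F (w ∷ A)
    linear₀ s u≈v+sw A = F-ma .linear zero s u≈v+sw others others
      where
      others : ∀ {u v} k → k ≢ zero → ∀ j → (u ∷ A) k j ≈ (v ∷ A) k j
      others zero    k≢0 = contradiction ≡.refl k≢0
      others (suc k) _ j = refl

    combination₀ : ∀ {k} (s : Vector Carrier k) (v : Matrix R k n) A →
      F ((λ l → sum λ j → s j * v j l) ∷ A) ≈ sum λ j → s j * F (v j ∷ A)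
    combination₀ {zero}  s v A = begin
      -- The zero row is 0 + (-1) * 0, so linearity turns the value into its difference with itself.
      F ((λ _ → 0#) ∷ A)                                  ≈⟨ linear₀ (- 1#) (λ _ → solve 0 (con (+ 0) := con (+ 0) :+ :- con (+ 1) :* con (+ 0)) refl) A ⟩
      F ((λ _ → 0#) ∷ A) + - 1# * F ((λ _ → 0#) ∷ A)      ≈⟨ solve 1 (λ x → x :+ :- con (+ 1) :* x := con (+ 0)) refl _ ⟩
      0#                                                  ∎
    combination₀ {suc k} s v A = begin
      F ((λ l → s zero * v zero l + sum λ j → s (suc j) * v (suc j) l) ∷ A)
        ≈⟨ linear₀ (s zero) (λ l → +-comm _ _) A ⟩
      F ((λ l → sum λ j → s (suc j) * v (suc j) l) ∷ A) + s zero * F (v zero ∷ A)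
        ≈⟨ +-comm _ _ ⟩
      s zero * F (v zero ∷ A) + F ((λ l → sum λ j → s (suc j) * v (suc j) l) ∷ A)
        ≈⟨ +-congˡ (combination₀ (s ∘ suc) (v ∘ suc) A) ⟩
      (sum λ j → s j * F (v j ∷ A)) ∎

  -- Polarisation: expand the vanishing value of `F` with u + v in both rows; the terms with equal
  -- rows drop out and the two mixed ones remain.
  swap₀₁ : ∀ {F : Matrix R (suc (suc m)) n → Carrier} → IsMultilinearAlternating F →
    ∀ u v A → F (u ∷ v ∷ A) ≈ - F (v ∷ u ∷ A)
  swap₀₁ {F = F} F-ma u v A = inverseˡ-unique _ _ (begin
    F (u ∷ v ∷ A) + F (v ∷ u ∷ A)
      ≈⟨ solve 2 (λ x y → x :+ y := (con (+ 0) :+ con (+ 1) :* y) :+ con (+ 1) :* (x :+ con (+ 1) :* con (+ 0))) refl _ _ ⟩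
    (0# + 1# * F (v ∷ u ∷ A)) + 1# * (F (u ∷ v ∷ A) + 1# * 0#)
      ≈⟨ +-cong (+-congʳ (equal u)) (*-congˡ (+-congˡ (*-congˡ (equal v)))) ⟨
    (F (u ∷ u ∷ A) + 1# * F (v ∷ u ∷ A)) + 1# * (F (u ∷ v ∷ A) + 1# * F (v ∷ v ∷ A))
      ≈⟨ +-cong (linear₀ F-ma 1# (λ _ → refl) _) (*-congˡ (linear₀ F-ma 1# (λ _ → refl) _)) ⟨
    F (u+v ∷ u ∷ A) + 1# * F (u+v ∷ v ∷ A)
      ≈⟨ linear₀ (∷-isMultilinearAlternating F-ma u+v) 1# (λ _ → refl) A ⟨
    F (u+v ∷ u+v ∷ A)
      ≈⟨ equal u+v ⟩
    0# ∎)
    where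
    u+v : Vector Carrier _
    u+v j = u j + 1# * v j
    equal : ∀ w → F (w ∷ w ∷ A) ≈ 0#
    equal w = F-ma .alternating zero (suc zero) ≡.refl (λ _ → refl)

  -- Only adjacent rows cancel. So once the row just below `v` is cleared, `v` is swapped past it,
  -- the other rows are cleared by induction with that row fixed, and `v` is swapped back.
  add-multiples : ∀ {F : Matrix R (suc m) n → Carrier} → IsMultilinearAlternating F →
    ∀ v (s : Vector Carrier m) {A B} → (∀ i j → A i j ≈ B i j + s i * v j) →
    F (v ∷ A) ≈ F (v ∷ B)
  add-multiples {zero}  F-ma v s A≈B+sv = F-ma .cong λ { zero j → refl }
  add-multiples {suc m} {F = F} F-ma v s {A} {B} A≈B+sv = begin
    F (v ∷ A)                                 ≈⟨ F-ma .cong (λ { zero j → refl ; (suc zero) j → refl ; (suc (suc i)) j → refl }) ⟩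
    F (v ∷ A zero ∷ tail A)                   ≈⟨ linear₀ (∷-isMultilinearAlternating F-ma v) (s zero) (A≈B+sv zero) (tail A) ⟩
    F (v ∷ B zero ∷ tail A) + s zero * F (v ∷ v ∷ tail A)
      ≈⟨ +-congˡ (*-congˡ (F-ma .alternating zero (suc zero) ≡.refl (λ _ → refl))) ⟩
    F (v ∷ B zero ∷ tail A) + s zero * 0#     ≈⟨ trans (+-congˡ (zeroʳ _)) (+-identityʳ _) ⟩
    F (v ∷ B zero ∷ tail A)                   ≈⟨ swap₀₁ F-ma v (B zero) (tail A) ⟩
    - F (B zero ∷ v ∷ tail A)
      ≈⟨ -‿cong (add-multiples (∷-isMultilinearAlternating F-ma (B zero)) v (tail s) (A≈B+sv ∘ suc)) ⟩
    - F (B zero ∷ v ∷ tail B)                 ≈⟨ swap₀₁ F-ma v (B zero) (tail B) ⟨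
    F (v ∷ B zero ∷ tail B)                   ≈⟨ F-ma .cong (λ { zero j → refl ; (suc zero) j → refl ; (suc (suc i)) j → refl }) ⟨
    F (v ∷ B)                                 ∎

  -- Row `j` reaches the top by `j` adjacent swaps; this is the source of the sign in the Laplace
  -- expansion.
  cycle : ∀ {F : Matrix R (suc m) n → Carrier} → IsMultilinearAlternating F →
    ∀ b j → F (b j ∷ removeAt b j) ≈ sgn j * F b
  cycle {F = F} F-ma b zero = begin
    F (b zero ∷ tail b)   ≈⟨ F-ma .cong (λ { zero j → refl ; (suc i) j → refl }) ⟩
    F b                   ≈⟨ *-identityˡ _ ⟨
    1# * F b              ∎
  cycle {suc m} {F = F} F-ma b (suc j) = begin
    F (b (suc j) ∷ removeAt b (suc j))
      ≈⟨ F-ma .cong (λ { zero j → refl ; (suc zero) j → refl ; (suc (suc i)) j → refl }) ⟩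
    F (b (suc j) ∷ b zero ∷ removeAt (tail b) j)
      ≈⟨ swap₀₁ F-ma (b (suc j)) (b zero) _ ⟩
    - F (b zero ∷ b (suc j) ∷ removeAt (tail b) j)
      ≈⟨ -‿cong (cycle (∷-isMultilinearAlternating F-ma (b zero)) (tail b) j) ⟩
    - (sgn j * F (b zero ∷ tail b))
      ≈⟨ -‿cong (*-congˡ (F-ma .cong (λ { zero j → refl ; (suc i) j → refl }))) ⟩
    - (sgn j * F b)
      ≈⟨ solve 2 (λ x y → :- (x :* y) := (:- con (+ 1) :* x) :* y) refl _ _ ⟩
    sgn (suc j) * F b ∎

  infixl 7 _⊗_
  _⊗_ : ∀ {k} → Matrix R m k → Matrix R k n → Matrix R m n
  (A ⊗ B) i l = sum λ j → A i j * B j l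

  -- Expanding the top row of the product puts a row `B j` on top. Its multiples can then be removed
  -- from the rows below, which deletes column `j` of `A` and row `j` of `B`. Induction with `B j`
  -- fixed produces the minor, and `cycle` restores `B` at the cost of the sign, so the Laplace
  -- expansion of `A` appears term by term.
  multilinearAlternating-⊗ : ∀ {F : Matrix R m n → Carrier} → IsMultilinearAlternating F →
    ∀ A B → F (A ⊗ B) ≈ det A * F B
  multilinearAlternating-⊗ {zero}  F-ma A B = trans (F-ma .cong (λ ())) (sym (*-identityˡ _))
  multilinearAlternating-⊗ {suc m} {F = F} F-ma A B = begin
    F (A ⊗ B)
      ≈⟨ F-ma .cong (λ { zero j → refl ; (suc i) j → refl }) ⟩
    F ((A ⊗ B) zero ∷ tail (A ⊗ B))
      ≈⟨ combination₀ F-ma (A zero) B _ ⟩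
    (sum λ j → A zero j * F (B j ∷ tail (A ⊗ B)))
      ≈⟨ sum-cong-≋ term ⟩
    (sum λ j → sgn j * A zero j * det (minor j) * F B)
      ≈⟨ *-distribʳ-sum (F B) (λ j → sgn j * A zero j * det (minor j)) ⟨
    det A * F B ∎
    where
    minor : Fin (suc m) → Matrix R m m
    minor j i = removeAt (A (suc i)) j
    term : ∀ j → A zero j * F (B j ∷ tail (A ⊗ B)) ≈ sgn j * A zero j * det (minor j) * F B
    term j = begin
      A zero j * F (B j ∷ tail (A ⊗ B))
        ≈⟨ *-congˡ (add-multiples F-ma (B j) (λ i → A (suc i) j) λ i l →
             trans (sum-remove {i = j} (λ k → A (suc i) k * B k l)) (+-comm _ _)) ⟩
      A zero j * F (B j ∷ (minor j ⊗ removeAt B j))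
        ≈⟨ *-congˡ (multilinearAlternating-⊗ (∷-isMultilinearAlternating F-ma (B j)) (minor j) (removeAt B j)) ⟩
      A zero j * (det (minor j) * F (B j ∷ removeAt B j))
        ≈⟨ *-congˡ (*-congˡ (cycle F-ma B j)) ⟩
      A zero j * (det (minor j) * (sgn j * F B))
        ≈⟨ solve 4 (λ a d s f → a :* (d :* (s :* f)) := s :* a :* d :* f) refl _ _ _ _ ⟩
      sgn j * A zero j * det (minor j) * F B ∎

  -- A pair (j, k) encodes the ordered pair of distinct columns j and `punchIn j k`; exchanging the
  -- columns reverses the sign and preserves `s`. The induction cancels the pairs involving column 0
  -- (`first` against `second`) and leaves the same problem for the others (`third`).
  signed-pairs-cancel : (s : Fin (suc n) → Fin n → Carrier) →
    (∀ j k j′ k′ → punchIn j k ≡ j′ → punchIn j′ k′ ≡ j → s j k ≈ s j′ k′) →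
    (sum λ j → sum λ k → sgn j * sgn k * s j k) ≈ 0#
  signed-pairs-cancel {zero}  s s-sym = +-identityˡ 0#
  signed-pairs-cancel {suc n} s s-sym = begin
    sum first + sum (λ j → second j + sum (third j))
      ≈⟨ +-congˡ (∑-distrib-+ second (sum ∘ third)) ⟩
    sum first + (sum second + sum (sum ∘ third))
      ≈⟨ +-assoc _ _ _ ⟨
    sum first + sum second + sum (sum ∘ third)
      ≈⟨ +-congʳ (∑-distrib-+ first second) ⟨
    sum (λ j → first j + second j) + sum (sum ∘ third)
      ≈⟨ +-cong (sum-zero _ first+second) (sum-cong-≋ λ j → sum-cong-≋ λ k →
           solve 3 (λ x y z → (:- con (+ 1) :* x) :* (:- con (+ 1) :* y) :* z := x :* y :* z) refl
             (sgn j) (sgn k) (s (suc j) (suc k))) ⟩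
    0# + (sum λ j → sum λ k → sgn j * sgn k * s (suc j) (suc k))
      ≈⟨ +-congˡ (signed-pairs-cancel (λ j k → s (suc j) (suc k)) λ j k j′ k′ p q →
           s-sym (suc j) (suc k) (suc j′) (suc k′) (≡.cong suc p) (≡.cong suc q)) ⟩
    0# + 0#
      ≈⟨ +-identityˡ 0# ⟩
    0# ∎
    where
    first second : Fin (suc n) → Carrier
    first k = 1# * sgn k * s zero k
    second j = sgn (suc j) * 1# * s (suc j) zero
    third : Fin (suc n) → Fin n → Carrier
    third j k = sgn (suc j) * sgn (suc k) * s (suc j) (suc k)
    first+second : ∀ k → first k + second k ≈ 0#
    first+second k = begin
      first k + second k
        ≈⟨ +-congˡ (*-congˡ (s-sym zero k (suc k) zero ≡.refl ≡.refl)) ⟨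
      1# * sgn k * s zero k + - 1# * sgn k * 1# * s zero k
        ≈⟨ solve 2 (λ x y → con (+ 1) :* x :* y :+ :- con (+ 1) :* x :* con (+ 1) :* y := con (+ 0)) refl _ _ ⟩
      0# ∎

  -- Both sides list in increasing order the indices other than `j` and `j′`, so deleting two
  -- columns in either order leaves the same minor.
  punchIn-punchIn : (j : Fin (suc (suc n))) (k : Fin (suc n)) → ∀ j′ k′ → punchIn j k ≡ j′ → punchIn j′ k′ ≡ j →
    ∀ i → punchIn j (punchIn k i) ≡ punchIn j′ (punchIn k′ i)
  punchIn-punchIn zero    k       _       zero    ≡.refl _ i = ≡.refl
  punchIn-punchIn (suc j) zero    _       k′      ≡.refl ≡.refl i = ≡.refl
  punchIn-punchIn (suc j) (suc k) _       (suc k′) ≡.refl q zero = ≡.refl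
  punchIn-punchIn (suc j) (suc k) _       (suc k′) ≡.refl q (suc i) =
    ≡.cong suc (punchIn-punchIn j k _ k′ ≡.refl (Fin.suc-injective q) i)

  det-cong : {A B : Matrix R n n} → (∀ i j → A i j ≈ B i j) → det A ≈ det B
  det-cong {zero}  A≈B = refl
  det-cong {suc n} A≈B = sum-cong-≋ λ j →
    *-cong (*-congˡ {sgn j} (A≈B zero j)) (det-cong λ i k → A≈B (suc i) (punchIn j k))

  det-linear : ∀ i s {A B C : Matrix R n n} →
    (∀ j → A i j ≈ B i j + s * C i j) →
    (∀ k → k ≢ i → ∀ j → A k j ≈ B k j) →
    (∀ k → k ≢ i → ∀ j → A k j ≈ C k j) →
    det A ≈ det B + s * det C
  det-linear zero s {A} {B} {C} A≈B+sC A≈B A≈C = sum-linear s _ _ _ λ j → begin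
    sgn j * A zero j * det (λ i → removeAt (A (suc i)) j)
      ≈⟨ *-congʳ (*-congˡ (A≈B+sC j)) ⟩
    sgn j * (B zero j + s * C zero j) * det (λ i → removeAt (A (suc i)) j)
      ≈⟨ solve 5 (λ g b s c d → g :* (b :+ s :* c) :* d := g :* b :* d :+ s :* (g :* c :* d)) refl _ _ _ _ _ ⟩
    sgn j * B zero j * det (λ i → removeAt (A (suc i)) j)
      + s * (sgn j * C zero j * det (λ i → removeAt (A (suc i)) j))
      ≈⟨ +-cong (*-congˡ (det-cong λ i k → A≈B (suc i) (λ ()) _))
                (*-congˡ (*-congˡ (det-cong λ i k → A≈C (suc i) (λ ()) _))) ⟩
    sgn j * B zero j * det (λ i → removeAt (B (suc i)) j)
      + s * (sgn j * C zero j * det (λ i → removeAt (C (suc i)) j)) ∎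
  det-linear {suc n} (suc i) s {A} {B} {C} A≈B+sC A≈B A≈C = sum-linear s _ _ _ λ j → begin
    sgn j * A zero j * det (λ i → removeAt (A (suc i)) j)
      ≈⟨ *-congˡ (det-linear i s (λ k → A≈B+sC (punchIn j k))
           (λ k k≢i l → A≈B (suc k) (k≢i ∘ Fin.suc-injective) (punchIn j l))
           (λ k k≢i l → A≈C (suc k) (k≢i ∘ Fin.suc-injective) (punchIn j l))) ⟩
    sgn j * A zero j * (det (λ i → removeAt (B (suc i)) j) + s * det (λ i → removeAt (C (suc i)) j))
      ≈⟨ solve 5 (λ g a s b c → g :* a :* (b :+ s :* c) := g :* a :* b :+ s :* (g :* a :* c)) refl _ _ _ _ _ ⟩
    sgn j * A zero j * det (λ i → removeAt (B (suc i)) j)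
      + s * (sgn j * A zero j * det (λ i → removeAt (C (suc i)) j))
      ≈⟨ +-cong (*-congʳ (*-congˡ (A≈B zero (λ ()) j)))
                (*-congˡ (*-congʳ (*-congˡ (A≈C zero (λ ()) j)))) ⟩
    sgn j * B zero j * det (λ i → removeAt (B (suc i)) j)
      + s * (sgn j * C zero j * det (λ i → removeAt (C (suc i)) j)) ∎

  -- For the top two rows, expanding twice gives a signed sum over ordered pairs of distinct
  -- columns, which cancels in pairs. For lower rows every minor of the first expansion already has
  -- two equal adjacent rows.
  det-alternating : ∀ i k → toℕ k ≡ suc (toℕ i) →
    ∀ {A : Matrix R n n} → (∀ j → A i j ≈ A k j) → det A ≈ 0#
  det-alternating {suc (suc n)} zero (suc zero) _ {A} A₀≈A₁ = begin
    (sum λ j → sgn j * A zero j * sum λ k → sgn k * A (suc zero) (punchIn j k) * D j k)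
      ≈⟨ sum-cong-≋ (λ j → trans (*-distribˡ-sum _ (λ k → sgn k * A (suc zero) (punchIn j k) * D j k))
           (sum-cong-≋ λ k → trans
             (*-congˡ (*-congʳ (*-congˡ (sym (A₀≈A₁ (punchIn j k))))))
             (solve 5 (λ g u h v d → g :* u :* (h :* v :* d) := g :* h :* (u :* v :* d)) refl
               (sgn j) (A zero j) (sgn k) (A zero (punchIn j k)) (D j k)))) ⟩
    (sum λ j → sum λ k → sgn j * sgn k * (A zero j * A zero (punchIn j k) * D j k))
      ≈⟨ signed-pairs-cancel (λ j k → A zero j * A zero (punchIn j k) * D j k) D-sym ⟩
    0# ∎
    where
    D : Fin (suc (suc n)) → Fin (suc n) → Carrier
    D j k = det (λ i → removeAt (removeAt (A (suc (suc i))) j) k)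
    D-sym : ∀ j k j′ k′ → punchIn j k ≡ j′ → punchIn j′ k′ ≡ j →
      A zero j * A zero (punchIn j k) * D j k ≈ A zero j′ * A zero (punchIn j′ k′) * D j′ k′
    D-sym j k j′ k′ p q = *-cong
      (trans (*-comm _ _) (*-cong (reflexive (≡.cong (A zero) p)) (reflexive (≡.cong (A zero) (≡.sym q)))))
      (det-cong λ i l → reflexive (≡.cong (A (suc (suc i))) (punchIn-punchIn j k j′ k′ p q l)))
  det-alternating zero (suc (suc k)) ()
  det-alternating (suc i) (suc k) k≡1+i {A} A≈ = sum-zero _ λ j →
    trans (*-congˡ {sgn j * A zero j} (det-alternating i k (ℕ.suc-injective k≡1+i) (λ l → A≈ (punchIn j l)))) (zeroʳ _)

  det-isMultilinearAlternating : IsMultilinearAlternating (det {n})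
  det-isMultilinearAlternating = record
    { cong = det-cong ; linear = det-linear ; alternating = det-alternating }

  det-⊗ : (A B : Matrix R n n) → det (A ⊗ B) ≈ det A * det B
  det-⊗ = multilinearAlternating-⊗ det-isMultilinearAlternating

  det-diagonal : (A : Matrix R n n) → (∀ i j → i ≢ j → A i j ≈ 0#) → det A ≈ prod (λ i → A i i)
  det-diagonal {zero}  A diag = refl
  det-diagonal {suc n} A diag = begin
    1# * A zero zero * det (λ i → A (suc i) ∘ suc)
      + (sum λ j → sgn (suc j) * A zero (suc j) * det (λ i → removeAt (A (suc i)) (suc j)))
      ≈⟨ +-congˡ (sum-zero {n} _ λ j → trans (*-congʳ (trans (*-congˡ (diag zero (suc j) λ ())) (zeroʳ _))) (zeroˡ _)) ⟩
    1# * A zero zero * det (λ i → A (suc i) ∘ suc) + 0#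
      ≈⟨ solve 2 (λ a d → con (+ 1) :* a :* d :+ con (+ 0) := a :* d) refl _ _ ⟩
    A zero zero * det (λ i → A (suc i) ∘ suc)
      ≈⟨ *-congˡ (det-diagonal (λ i → A (suc i) ∘ suc) λ i j i≢j → diag (suc i) (suc j) (i≢j ∘ Fin.suc-injective)) ⟩
    A zero zero * prod (λ i → A (suc i) (suc i)) ∎

-- Monic polynomials and division by x - r.

module MonicPolynomials {c ℓ} (R : CommutativeRing c ℓ) where
  open import Data.Vec using (Vec; []; _∷_; replicate)
  open CommutativeRing R hiding (zero)
  open import Algebra.Properties.Semiring.Exp semiring using (_^_)
  open import Relation.Binary.Reasoning.Setoid setoid
  open RingLemmas R

  -- The monic polynomial of degree d with the given lower coefficients,
  -- constant term first.
  monic : ∀ {d} → Vec Carrier d → Carrier → Carrier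
  monic []       x = 1#
  monic (s ∷ ss) x = s + x * monic ss x

  -- Horner's scheme: the coefficients of the quotient by x - r are the values at `r` of the
  -- successive tails.
  quotient : ∀ {d} → Vec Carrier (suc d) → Carrier → Vec Carrier d
  quotient (_ ∷ [])         r = []
  quotient (_ ∷ ss@(_ ∷ _)) r = monic ss r ∷ quotient ss r

  monic-quotient : ∀ {d} (ss : Vec Carrier (suc d)) r x →
    monic ss x ≈ (x - r) * monic (quotient ss r) x + monic ss r
  monic-quotient (s ∷ []) r x =
    solve 3 (λ s r x → s :+ x :* con (+ 1) := (x :- r) :* con (+ 1) :+ (s :+ r :* con (+ 1))) refl s r x
  monic-quotient (s ∷ ss@(_ ∷ _)) r x = begin
    s + x * monic ss x
      ≈⟨ +-congˡ (*-congˡ (monic-quotient ss r x)) ⟩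
    s + x * ((x - r) * monic (quotient ss r) x + monic ss r)
      ≈⟨ solve 5 (λ s x r m n → s :+ x :* ((x :- r) :* m :+ n) := (x :- r) :* (n :+ x :* m) :+ (s :+ r :* n))
           refl s x r (monic (quotient ss r) x) (monic ss r) ⟩
    (x - r) * (monic ss r + x * monic (quotient ss r) x) + (s + r * monic ss r) ∎

  monic-^ : ∀ d x → monic (replicate d 0#) x ≈ x ^ d
  monic-^ zero    x = refl
  monic-^ (suc d) x = trans (+-identityˡ _) (*-congˡ (monic-^ d x))

-- Finite fields: inverses, substitutions in sums and products, power sums.

module FiniteFieldLemmas {c ℓ₁ ℓ₂ q} (F : FiniteField c ℓ₁ ℓ₂ q) where
  open import Data.Vec using (Vec; []; _∷_; replicate)
  open FiniteField F using (commutativeRing; _#_; _≟_; _⁻¹; ⁻¹-inverseʳ; hasInverse?; tight;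
    heytingCommutativeRing; enumeration; EnumeratesNonzero)
  open CommutativeRing commutativeRing hiding (zero)
  open import Algebra.Apartness.Properties.HeytingCommutativeRing heytingCommutativeRing using (1#0; invertibleʳ⇒#; x-0≈x)
  open import Algebra.Properties.AbelianGroup +-abelianGroup using (identityʳ-unique; x∙y⁻¹≈ε⇒x≈y; //-rightDividesˡ; //-rightDividesʳ; inverseʳ-unique)
  open import Algebra.Properties.CommutativeSemigroup *-commutativeSemigroup using (x∙yz≈y∙xz)
  open import Algebra.Properties.Ring ring using ([y-z]x≈yx-zx)
  open import Algebra.Properties.Semiring.Exp semiring using (_^_; ^-congˡ; ^-homo-*)
  open import Algebra.Properties.CommutativeSemiring.Exp commutativeSemiring using (^-distrib-*)
  open import Algebra.Properties.Semiring.Mult semiring using () renaming (_×_ to _·_)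
  open import Algebra.Properties.Semiring.Sum semiring
  open import Algebra.Properties.CommutativeMonoid.Sum *-commutativeMonoid using ()
    renaming (sum to prod; sum-permute to prod-permute; ∑-distrib-+ to prod-distrib-*;
      sum-cong-≋ to prod-cong; sum-replicate to prod-replicate)
  open import Relation.Binary.Reasoning.Setoid setoid
  open MonicPolynomials commutativeRing

  #0⇒≉0 : ∀ {x} → x # 0# → ¬ (x ≈ 0#)
  #0⇒≉0 x#0 x≈0 = proj₂ (tight _ _) x≈0 x#0

  ≉0⇒#0 : ∀ {x} → ¬ (x ≈ 0#) → x # 0#
  ≉0⇒#0 {x} x≉0 = invertibleʳ⇒# (x ⁻¹ , trans (*-congʳ (x-0≈x x)) (⁻¹-inverseʳ x≉0))

  1≉0 : ¬ (1# ≈ 0#)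
  1≉0 = #0⇒≉0 1#0

  x*y≈1⇒x≉0 : ∀ {x y} → x * y ≈ 1# → ¬ (x ≈ 0#)
  x*y≈1⇒x≉0 x*y≈1 x≈0 = 1≉0 (trans (sym x*y≈1) (trans (*-congʳ x≈0) (zeroˡ _)))

  *-cancelˡ : ∀ {x y z} → ¬ (x ≈ 0#) → x * y ≈ x * z → y ≈ z
  *-cancelˡ {x} {y} {z} x≉0 xy≈xz = begin
    y                ≈⟨ insert y ⟩
    x ⁻¹ * (x * y)   ≈⟨ *-congˡ xy≈xz ⟩
    x ⁻¹ * (x * z)   ≈⟨ insert z ⟨
    z                ∎
    where
    insert : ∀ y → y ≈ x ⁻¹ * (x * y)
    insert y = begin
      y               ≈⟨ *-identityˡ y ⟨
      1# * y          ≈⟨ *-congʳ (⁻¹-inverseʳ x≉0) ⟨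
      x * x ⁻¹ * y    ≈⟨ trans (*-assoc _ _ _) (x∙yz≈y∙xz x (x ⁻¹) y) ⟩
      x ⁻¹ * (x * y)  ∎

  x*y≈0⇒y≈0 : ∀ {x y} → ¬ (x ≈ 0#) → x * y ≈ 0# → y ≈ 0#
  x*y≈0⇒y≈0 x≉0 xy≈0 = *-cancelˡ x≉0 (trans xy≈0 (sym (zeroʳ _)))

  *-≉0 : ∀ {x y} → ¬ (x ≈ 0#) → ¬ (y ≈ 0#) → ¬ (x * y ≈ 0#)
  *-≉0 x≉0 y≉0 xy≈0 = y≉0 (x*y≈0⇒y≈0 x≉0 xy≈0)

  ^-≉0 : ∀ {x} n → ¬ (x ≈ 0#) → ¬ (x ^ n ≈ 0#)
  ^-≉0 zero    x≉0 = 1≉0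
  ^-≉0 (suc n) x≉0 = *-≉0 x≉0 (^-≉0 n x≉0)

  ⁻¹-unique : ∀ {x y} → x * y ≈ 1# → x ⁻¹ ≈ y
  ⁻¹-unique xy≈1 = *-cancelˡ x≉0 (trans (⁻¹-inverseʳ x≉0) (sym xy≈1))
    where x≉0 = x*y≈1⇒x≉0 xy≈1

  ⁻¹-≉0 : ∀ {x} → ¬ (x ≈ 0#) → ¬ (x ⁻¹ ≈ 0#)
  ⁻¹-≉0 x≉0 = x*y≈1⇒x≉0 (trans (*-comm _ _) (⁻¹-inverseʳ x≉0))

  ⁻¹-involutive : ∀ {x} → ¬ (x ≈ 0#) → (x ⁻¹) ⁻¹ ≈ x
  ⁻¹-involutive x≉0 = ⁻¹-unique (trans (*-comm _ _) (⁻¹-inverseʳ x≉0))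

  -- `_⁻¹` searches separately for each representative: two successful searches agree because
  -- inverses are unique, two failed ones because both return the default 0.
  ⁻¹-cong : ∀ {x y} → x ≈ y → x ⁻¹ ≈ y ⁻¹
  ⁻¹-cong {x} {y} x≈y with hasInverse? x
  ... | yes (_ , xz≈1) = sym (⁻¹-unique (trans (*-congʳ (sym x≈y)) xz≈1))
  ... | no ∄z with hasInverse? y
  ...   | yes (z , yz≈1) = contradiction (z , trans (*-congʳ x≈y) yz≈1) ∄z
  ...   | no _           = refl

  -- Carries a bijection of field elements over to their indices, so that reindexing by a
  -- permutation becomes a change of variable t ↦ f t in sums and products.
  inducedPermutation : ∀ {n} (a : Vector Carrier n) → Injective _≡_ _≈_ a →
    (f g : Carrier → Carrier) → (∀ {x y} → x ≈ y → f x ≈ f y) → (∀ {x y} → x ≈ y → g x ≈ g y) →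
    (∀ i → f (g (a i)) ≈ a i) → (∀ i → g (f (a i)) ≈ a i) →
    (∀ i → ∃[ j ] a j ≈ f (a i)) → (∀ i → ∃[ j ] a j ≈ g (a i)) →
    ∃[ π ] (∀ i → a (π ⟨$⟩ʳ i) ≈ f (a i))
  inducedPermutation a a-inj f g f-cong g-cong fg gf σ τ =
    permutation (proj₁ ∘ σ) (proj₁ ∘ τ)
      (λ i → a-inj (trans (proj₂ (σ _)) (trans (f-cong (proj₂ (τ i))) (fg i))))
      (λ i → a-inj (trans (proj₂ (τ _)) (trans (g-cong (proj₂ (σ i))) (gf i))))
    , proj₂ ∘ σ

  -- Translation by 1 permutes the field, so adding 1 to each of the q summands leaves the sum of
  -- all elements unchanged.
  q·1≈0 : q · 1# ≈ 0#
  q·1≈0 = identityʳ-unique (sum element) (q · 1#) (sym (begin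
    sum element                       ≈⟨ sum-permute element (proj₁ π) ⟩
    sum (element ∘ (proj₁ π ⟨$⟩ʳ_))   ≈⟨ sum-cong-≋ (proj₂ π) ⟩
    sum (λ i → element i + 1#)        ≈⟨ ∑-distrib-+ element (λ _ → 1#) ⟩
    sum element + sum {q} (λ _ → 1#)  ≈⟨ +-congˡ (sum-replicate q) ⟩
    sum element + q · 1#              ∎))
    where
    open Bijection enumeration using (injective; strictlySurjective) renaming (to to element)
    π = inducedPermutation element injective (_+ 1#) (_- 1#) +-congʳ +-congʳ
      (λ i → //-rightDividesˡ 1# (element i))
      (λ i → //-rightDividesʳ 1# (element i))
      (λ i → strictlySurjective _) (λ i → strictlySurjective _)

  -- Dividing out the first root leaves a monic polynomial of smaller degree that vanishes at the
  -- others; in degree 0 the polynomial is 1.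
  monic-roots : ∀ {d} (ss : Vec Carrier d) (r : Vector Carrier (suc d)) → Injective _≡_ _≈_ r →
    ¬ (∀ i → monic ss (r i) ≈ 0#)
  monic-roots {zero}  []  r r-inj roots = 1≉0 (roots zero)
  monic-roots {suc d} ss r r-inj roots = monic-roots (quotient ss (r zero)) (r ∘ suc)
    (Fin.suc-injective ∘ r-inj) λ i → x*y≈0⇒y≈0
      (λ r-r≈0 → contradiction (r-inj (x∙y⁻¹≈ε⇒x≈y _ _ r-r≈0)) λ ())
      (begin
        (r (suc i) - r zero) * monic (quotient ss (r zero)) (r (suc i))
          ≈⟨ +-identityʳ _ ⟨
        (r (suc i) - r zero) * monic (quotient ss (r zero)) (r (suc i)) + 0#
          ≈⟨ +-congˡ (roots zero) ⟨
        (r (suc i) - r zero) * monic (quotient ss (r zero)) (r (suc i)) + monic ss (r zero)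
          ≈⟨ monic-quotient ss (r zero) (r (suc i)) ⟨
        monic ss (r (suc i))
          ≈⟨ roots (suc i) ⟩
        0# ∎)

  module NonzeroElements {N} {a : Vector Carrier N} (a-enum : EnumeratesNonzero a) where
    open EnumeratesNonzero a-enum

    a≉0 : ∀ i → ¬ (a i ≈ 0#)
    a≉0 i = #0⇒≉0 (nonzero i)

    index : ∀ {x} → ¬ (x ≈ 0#) → ∃[ i ] a i ≈ x
    index x≉0 = exhaustive _ (≉0⇒#0 x≉0)

    scaling : ∀ {b} → ¬ (b ≈ 0#) → ∃[ π ] (∀ i → a (π ⟨$⟩ʳ i) ≈ b * a i)
    scaling {b} b≉0 = inducedPermutation a injective (b *_) (b ⁻¹ *_) *-congˡ *-congˡ
      (λ i → cancel (⁻¹-inverseʳ b≉0)) (λ i → cancel (trans (*-comm _ _) (⁻¹-inverseʳ b≉0)))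
      (λ i → index (*-≉0 b≉0 (a≉0 i))) (λ i → index (*-≉0 (⁻¹-≉0 b≉0) (a≉0 i)))
      where
      cancel : ∀ {x y z} → x * y ≈ 1# → x * (y * z) ≈ z
      cancel xy≈1 = trans (sym (*-assoc _ _ _)) (trans (*-congʳ xy≈1) (*-identityˡ _))

    inversion : ∃[ π ] (∀ i → a (π ⟨$⟩ʳ i) ≈ a i ⁻¹)
    inversion = inducedPermutation a injective _⁻¹ _⁻¹ ⁻¹-cong ⁻¹-cong
      (λ i → ⁻¹-involutive (a≉0 i)) (λ i → ⁻¹-involutive (a≉0 i))
      (λ i → index (⁻¹-≉0 (a≉0 i))) (λ i → index (⁻¹-≉0 (a≉0 i)))

    prod-≉0 : ∀ {n} (f : Vector Carrier n) → (∀ i → ¬ (f i ≈ 0#)) → ¬ (prod f ≈ 0#)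
    prod-≉0 {zero}  f f≉0 = 1≉0
    prod-≉0 {suc n} f f≉0 = *-≉0 (f≉0 zero) (prod-≉0 (f ∘ suc) (f≉0 ∘ suc))

    fermat : ∀ {b} → ¬ (b ≈ 0#) → b ^ N ≈ 1#
    fermat {b} b≉0 = *-cancelˡ (prod-≉0 a a≉0) (begin
      prod a * b ^ N                      ≈⟨ *-comm _ _ ⟩
      b ^ N * prod a                      ≈⟨ *-congʳ (prod-replicate N) ⟨
      prod {N} (λ _ → b) * prod a         ≈⟨ prod-distrib-* (λ _ → b) a ⟨
      prod (λ i → b * a i)                ≈⟨ prod-cong (proj₂ (scaling b≉0)) ⟨
      prod (a ∘ (proj₁ (scaling b≉0) ⟨$⟩ʳ_)) ≈⟨ prod-permute a (proj₁ (scaling b≉0)) ⟨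
      prod a                              ≈⟨ *-identityʳ _ ⟨
      prod a * 1#                         ∎)

    ^-period : ∀ {b} m → ¬ (b ≈ 0#) → b ^ (N ℕ.+ m) ≈ b ^ m
    ^-period {b} m b≉0 = begin
      b ^ (N ℕ.+ m)    ≈⟨ ^-homo-* b N m ⟩
      b ^ N * b ^ m    ≈⟨ *-congʳ (fermat b≉0) ⟩
      1# * b ^ m       ≈⟨ *-identityˡ _ ⟩
      b ^ m            ∎

    ^-period-* : ∀ {b} d m → ¬ (b ≈ 0#) → b ^ (m ℕ.+ d ℕ.* N) ≈ b ^ m
    ^-period-* {b} zero m b≉0 = reflexive (≡.cong (b ^_) (ℕ.+-identityʳ m))
    ^-period-* {b} (suc d) m b≉0 = begin
      b ^ (m ℕ.+ (N ℕ.+ d ℕ.* N))    ≡⟨ ≡.cong (b ^_) (ℕ+.x∙yz≈y∙xz m N (d ℕ.* N)) ⟩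
      b ^ (N ℕ.+ (m ℕ.+ d ℕ.* N))    ≈⟨ ^-period (m ℕ.+ d ℕ.* N) b≉0 ⟩
      b ^ (m ℕ.+ d ℕ.* N)            ≈⟨ ^-period-* d m b≉0 ⟩
      b ^ m                          ∎

    -- This is det D = 1. Inversion permutes the nonzero elements, so one of the two products of
    -- inverses may be replaced by the product of the elements.
    inverse-square-prod : prod (λ i → a i ⁻¹ * a i ⁻¹) ≈ 1#
    inverse-square-prod = begin
      prod (λ i → a i ⁻¹ * a i ⁻¹)                 ≈⟨ prod-distrib-* (_⁻¹ ∘ a) (_⁻¹ ∘ a) ⟩
      prod (_⁻¹ ∘ a) * prod (_⁻¹ ∘ a)              ≈⟨ *-congʳ (prod-cong (proj₂ inversion)) ⟨
      prod (a ∘ (proj₁ inversion ⟨$⟩ʳ_)) * prod (_⁻¹ ∘ a) ≈⟨ *-congʳ (prod-permute a (proj₁ inversion)) ⟨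
      prod a * prod (_⁻¹ ∘ a)                      ≈⟨ prod-distrib-* a (_⁻¹ ∘ a) ⟨
      prod (λ i → a i * a i ⁻¹)                    ≈⟨ prod-cong (λ i → ⁻¹-inverseʳ (a≉0 i)) ⟩
      prod {N} (λ _ → 1#)                          ≈⟨ prod-one N ⟩
      1#                                           ∎
      where
      prod-one : ∀ n → prod {n} (λ _ → 1#) ≈ 1#
      prod-one zero    = refl
      prod-one (suc n) = trans (*-identityˡ _) (prod-one n)

    -- Takes the place of a primitive root: each exponent below N gets its own witness, since x ^ (r
    -- + 1) - 1 has too few roots.
    nonroot : ∀ r → suc r ℕ.< N → ∃[ i ] ¬ (a i ^ suc r ≈ 1#)
    nonroot r 1+r<N = Fin.¬∀⟶∃¬ N (λ i → a i ^ suc r ≈ 1#) (λ i → a i ^ suc r ≟ 1#) λ a^r≈1 →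
      -- The bound r + 2 ≤ N supplies one point more than the degree r + 1.
      monic-roots (- 1# ∷ replicate r 0#) (λ i → a (inject≤ i 1+r<N))
        (Fin.inject≤-injective 1+r<N 1+r<N _ _ ∘ injective) λ i → begin
          - 1# + a (inject≤ i 1+r<N) * monic (replicate r 0#) (a (inject≤ i 1+r<N))
            ≈⟨ +-congˡ (*-congˡ (monic-^ r _)) ⟩
          - 1# + a (inject≤ i 1+r<N) ^ suc r
            ≈⟨ +-congˡ (a^r≈1 _) ⟩
          - 1# + 1#
            ≈⟨ -‿inverseˡ 1# ⟩
          0# ∎

    powerSum : ℕ → Carrier
    powerSum m = sum λ i → a i ^ m

    powerSum-∣ : suc N ≡ q → ∀ {m} → N ∣ m → powerSum m ≈ - 1#
    powerSum-∣ 1+N≡q {m} (divides d m≡dN) = begin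
      powerSum m             ≈⟨ sum-cong-≋ (λ i → trans (reflexive (≡.cong (a i ^_) m≡dN)) (^-period-* d 0 (a≉0 i))) ⟩
      sum {N} (λ _ → 1#)     ≈⟨ sum-replicate N ⟩
      N · 1#                 ≈⟨ inverseʳ-unique _ _ (trans (reflexive (≡.cong (_· 1#) 1+N≡q)) q·1≈0) ⟩
      - 1#                   ∎

    -- (b ^ m - 1) * powerSum m ≈ 0 by reindexing along t ↦ b * t.
    powerSum-zero : ∀ {b} m → ¬ (b ≈ 0#) → ¬ (b ^ m ≈ 1#) → powerSum m ≈ 0#
    powerSum-zero {b} m b≉0 b^m≉1 = x*y≈0⇒y≈0 (b^m≉1 ∘ x∙y⁻¹≈ε⇒x≈y _ _) (begin
      (b ^ m - 1#) * powerSum m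
        ≈⟨ [y-z]x≈yx-zx (powerSum m) (b ^ m) 1# ⟩
      b ^ m * powerSum m - 1# * powerSum m
        ≈⟨ +-cong (*-distribˡ-sum (b ^ m) (λ j → a j ^ m)) (-‿cong (*-identityˡ _)) ⟩
      (sum λ j → b ^ m * a j ^ m) - powerSum m
        ≈⟨ +-congʳ (sum-cong-≋ λ j → trans (sym (^-distrib-* b (a j) m)) (^-congˡ m (sym (proj₂ π j)))) ⟩
      (sum λ j → a (proj₁ π ⟨$⟩ʳ j) ^ m) - powerSum m
        ≈⟨ +-congʳ (sum-permute (λ j → a j ^ m) (proj₁ π)) ⟨
      powerSum m - powerSum m
        ≈⟨ -‿inverseʳ _ ⟩
      0# ∎)
      where π = scaling b≉0

    -- By Fermat only the nonzero residue of `m` matters, and it is small enough for `nonroot` to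
    -- give the multiplier that `powerSum-zero` asks for.
    powerSum-∤ : .{{_ : ℕ.NonZero N}} → ∀ {m} → ¬ (N ∣ m) → powerSum m ≈ 0#
    powerSum-∤ {m} N∤m = helper (m % N) ≡.refl
      where
      helper : ∀ r → m % N ≡ r → powerSum m ≈ 0#
      helper zero    m%N≡0   = contradiction (m%n≡0⇒n∣m m N m%N≡0) N∤m
      helper (suc r) m%N≡1+r = powerSum-zero m b≉0 (λ b^m≈1 → b^r≉1 (trans (sym b^m≈b^r) b^m≈1))
        where
        i,b^r≉1 = nonroot r (≡.subst (ℕ._< N) m%N≡1+r (ℕ.m%n<n m N))
        b = a (proj₁ i,b^r≉1)
        b^r≉1 = proj₂ i,b^r≉1
        b≉0 = a≉0 (proj₁ i,b^r≉1)
        b^m≈b^r : b ^ m ≈ b ^ suc r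
        b^m≈b^r = begin
          b ^ m                            ≡⟨ ≡.cong (b ^_) (ℕ.m≡m%n+[m/n]*n m N) ⟩
          b ^ (m % N ℕ.+ (m / N) ℕ.* N)    ≈⟨ ^-period-* (m / N) (m % N) b≉0 ⟩
          b ^ (m % N)                      ≡⟨ ≡.cong (b ^_) m%N≡1+r ⟩
          b ^ suc r                        ∎

-- Diagonal matrices and scaling of rows and columns.

module DiagonalLemmas {c ℓ} (R : CommutativeRing c ℓ) where
  open CommutativeRing R hiding (zero)
  open import Algebra.Properties.Semiring.Sum semiring
  open import Algebra.Properties.CommutativeMonoid.Sum *-commutativeMonoid using () renaming (sum to prod; sum-cong-≋ to prod-cong)
  open import Relation.Binary.Reasoning.Setoid setoid
  open DeterminantLemmas R

  private
    det : ∀ {n} → Matrix R n n → Carrier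
    det = determinant R

  diagonal : ∀ {n} → Vector Carrier n → Matrix R n n
  diagonal d i j with i Fin.≟ j
  ... | yes _ = d i
  ... | no  _ = 0#

  diagonal-≡ : ∀ {n} (d : Vector Carrier n) i → diagonal d i i ≈ d i
  diagonal-≡ d i with i Fin.≟ i
  ... | yes _  = refl
  ... | no i≢i = contradiction ≡.refl i≢i

  diagonal-≢ : ∀ {n} (d : Vector Carrier n) i j → i ≢ j → diagonal d i j ≈ 0#
  diagonal-≢ d i j i≢j with i Fin.≟ j
  ... | yes i≡j = contradiction i≡j i≢j
  ... | no _    = refl

  det-diagonal-matrix : ∀ {n} (d : Vector Carrier n) → det (diagonal d) ≈ prod d
  det-diagonal-matrix d = trans (det-diagonal (diagonal d) (diagonal-≢ d)) (prod-cong (diagonal-≡ d))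

  sum-single : ∀ {n} i (f : Vector Carrier n) → (∀ j → j ≢ i → f j ≈ 0#) → sum f ≈ f i
  sum-single {suc n} i f f≈0 = begin
    sum f                       ≈⟨ sum-remove f ⟩
    f i + sum (removeAt f i)    ≈⟨ +-congˡ (sum-zero _ λ j → f≈0 (punchIn i j) (Fin.punchInᵢ≢i i j)) ⟩
    f i + 0#                    ≈⟨ +-identityʳ _ ⟩
    f i                         ∎

  det-scaleRows : ∀ {n} d (A : Matrix R n n) → det (λ i j → d i * A i j) ≈ prod d * det A
  det-scaleRows d A = begin
    det (λ i j → d i * A i j)    ≈⟨ det-cong (λ i j → trans
      (sum-single i (λ k → diagonal d i k * A k j) λ k k≢i →
        trans (*-congʳ (diagonal-≢ d i k (k≢i ∘ ≡.sym))) (zeroˡ _))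
      (*-congʳ (diagonal-≡ d i))) ⟨
    det (diagonal d ⊗ A)         ≈⟨ det-⊗ (diagonal d) A ⟩
    det (diagonal d) * det A     ≈⟨ *-congʳ (det-diagonal-matrix d) ⟩
    prod d * det A               ∎

  det-scaleColumns : ∀ {n} d (A : Matrix R n n) → det (λ i j → A i j * d j) ≈ det A * prod d
  det-scaleColumns d A = begin
    det (λ i j → A i j * d j)    ≈⟨ det-cong (λ i j → trans
      (sum-single j (λ k → A i k * diagonal d k j) λ k k≢j →
        trans (*-congˡ (diagonal-≢ d k j k≢j)) (zeroʳ _))
      (*-congˡ (diagonal-≡ d j))) ⟨
    det (A ⊗ diagonal d)         ≈⟨ det-⊗ A (diagonal d) ⟩
    det A * det (diagonal d)     ≈⟨ *-congˡ (det-diagonal-matrix d) ⟩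
    det A * prod d               ∎

-- Signs, products, and identities around t² - t + 1.

module EvaluationIdentities {c ℓ} (R : CommutativeRing c ℓ) where
  open CommutativeRing R hiding (zero)
  open import Algebra.Properties.AbelianGroup +-abelianGroup using (⁻¹-involutive)
  open import Algebra.Properties.Semiring.Exp semiring using (_^_; ^-congˡ; ^-homo-*)
  open import Algebra.Properties.CommutativeSemiring.Exp commutativeSemiring using (^-distrib-*)
  open import Algebra.Properties.Semiring.Mult semiring using (×1-homo-*) renaming (_×_ to _·_)
  open import Algebra.Properties.CommutativeMonoid.Sum *-commutativeMonoid using ()
    renaming (sum to prod; ∑-distrib-+ to prod-distrib-*;
      sum-cong-≋ to prod-cong; sum-replicate to prod-replicate)
  open import Relation.Binary.Reasoning.Setoid setoid
  open RingLemmas R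

  ε : ℕ → Carrier
  ε k = (- 1#) ^ k

  ε-2+ : ∀ m → ε (2 ℕ.+ m) ≈ ε m
  ε-2+ m = solve 1 (λ x → :- con (+ 1) :* (:- con (+ 1) :* x) := x) refl (ε m)

  ε-even : ∀ m → ε (m ℕ.* 2) ≈ 1#
  ε-even zero    = refl
  ε-even (suc m) = trans (ε-2+ (m ℕ.* 2)) (ε-even m)

  ε-odd : ∀ m → ε (suc (m ℕ.* 2)) ≈ - 1#
  ε-odd m = trans (*-congˡ (ε-even m)) (*-identityʳ _)

  -- Consecutive factors ε (2i + 1) and ε (2i + 2) multiply to -1, one sign for each of the `h`
  -- pairs.
  prod-ε : ∀ h → prod {h ℕ.* 2} (λ i → ε (suc (toℕ i))) ≈ ε h
  prod-ε zero    = refl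
  prod-ε (suc h) = begin
    ε 1 * (ε 2 * prod {h ℕ.* 2} (λ i → ε (3 ℕ.+ toℕ i)))
      ≈⟨ *-congˡ (*-congˡ (trans (prod-cong {h ℕ.* 2} {λ i → ε (3 ℕ.+ toℕ i)} {λ i → ε (suc (toℕ i))} (λ i → ε-2+ (suc (toℕ i)))) (prod-ε h))) ⟩
    ε 1 * (ε 2 * ε h)
      ≈⟨ solve 1 (λ x → (:- con (+ 1) :* con (+ 1)) :* ((:- con (+ 1) :* (:- con (+ 1) :* con (+ 1))) :* x) := :- con (+ 1) :* x) refl (ε h) ⟩
    ε (suc h) ∎

  prod-++ : ∀ m l (f : ℕ → Carrier) →
    prod {m ℕ.+ l} (f ∘ toℕ) ≈ prod {m} (f ∘ toℕ) * prod {l} (λ i → f (m ℕ.+ toℕ i))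
  prod-++ zero    l f = sym (*-identityˡ _)
  prod-++ (suc m) l f = trans (*-congˡ (prod-++ m l (f ∘ suc))) (sym (*-assoc _ _ _))

  prod-scaled : ∀ m x (f g : ℕ → Carrier) → (∀ j → j ℕ.< m → f j ≈ g j * x) →
    prod {m} (f ∘ toℕ) ≈ prod {m} (g ∘ toℕ) * x ^ m
  prod-scaled m x f g f≈gx = begin
    prod {m} (f ∘ toℕ)                         ≈⟨ prod-cong (λ i → f≈gx (toℕ i) (Fin.toℕ<n i)) ⟩
    prod {m} (λ i → g (toℕ i) * x)             ≈⟨ prod-distrib-* {m} (g ∘ toℕ) (λ _ → x) ⟩
    prod {m} (g ∘ toℕ) * prod {m} (λ _ → x)    ≈⟨ *-congˡ (prod-replicate m) ⟩
    prod {m} (g ∘ toℕ) * x ^ m                 ∎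

  prod-scaled-++ : ∀ m l x y (f g : ℕ → Carrier) →
    (∀ j → j ℕ.< m → f j ≈ g j * x) →
    (∀ j → j ℕ.< l → f (m ℕ.+ j) ≈ g (m ℕ.+ j) * y) →
    prod {m ℕ.+ l} (f ∘ toℕ) ≈ prod {m ℕ.+ l} (g ∘ toℕ) * (x ^ m * y ^ l)
  prod-scaled-++ m l x y f g f≈gx f≈gy = begin
    prod {m ℕ.+ l} (f ∘ toℕ)
      ≈⟨ prod-++ m l f ⟩
    prod {m} (f ∘ toℕ) * prod {l} (λ i → f (m ℕ.+ toℕ i))
      ≈⟨ *-cong (prod-scaled m x f g f≈gx) (prod-scaled l y (λ j → f (m ℕ.+ j)) (λ j → g (m ℕ.+ j)) f≈gy) ⟩
    (prod {m} (g ∘ toℕ) * x ^ m) * (prod {l} (λ i → g (m ℕ.+ toℕ i)) * y ^ l)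
      ≈⟨ solve 4 (λ a b c d → (a :* b) :* (c :* d) := (a :* c) :* (b :* d)) refl _ _ _ _ ⟩
    (prod {m} (g ∘ toℕ) * prod {l} (λ i → g (m ℕ.+ toℕ i))) * (x ^ m * y ^ l)
      ≈⟨ *-congʳ (prod-++ m l g) ⟨
    prod {m ℕ.+ l} (g ∘ toℕ) * (x ^ m * y ^ l) ∎

  image-^ : ∀ i n → image (i ℤ.^ n) ≈ image i ^ n
  image-^ i zero    = +-identityʳ 1#
  image-^ i (suc n) = trans (image-* i (i ℤ.^ n)) (*-congˡ (image-^ i n))

  image-±2^ : ∀ e n → image (-1ℤ ℤ.^ e ℤ.* (+ 2) ℤ.^ n) ≈ ε e * (1# + 1#) ^ n
  image-±2^ e n = trans (image-* (-1ℤ ℤ.^ e) ((+ 2) ℤ.^ n)) (*-cong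
    (trans (image-^ -1ℤ e) (^-congˡ e (-‿cong (+-identityʳ 1#))))
    (trans (image-^ (+ 2) n) (^-congˡ n (+-congˡ (+-identityʳ 1#)))))

  -- Here x = -1/3 and x + 1 = -2x.
  power-evaluation : ∀ n x → ε n ≈ - 1# → x + x + x ≈ - 1# → x ^ suc (n ℕ.* 3) ≈ 1# →
    (x + 1#) ^ n * x ^ suc (n ℕ.+ n) ≈ - 1# * (1# + 1#) ^ n
  power-evaluation n x εn≈-1 3x≈-1 x^N≈1 = begin
    (x + 1#) ^ n * x ^ suc (n ℕ.+ n)
      ≈⟨ *-congʳ (trans (^-congˡ n x+1≈-2x) (trans (^-distrib-* _ x n) (*-congʳ (^-distrib-* _ _ n)))) ⟩
    (ε n * (1# + 1#) ^ n * x ^ n) * x ^ suc (n ℕ.+ n)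
      ≈⟨ *-assoc _ _ _ ⟩
    ε n * (1# + 1#) ^ n * (x ^ n * x ^ suc (n ℕ.+ n))
      ≈⟨ *-cong (*-congʳ εn≈-1) (sym (^-homo-* x n (suc (n ℕ.+ n)))) ⟩
    - 1# * (1# + 1#) ^ n * x ^ (n ℕ.+ suc (n ℕ.+ n))
      ≈⟨ *-congˡ (trans (reflexive (≡.cong (x ^_) (ℕsolve 1 (λ n → n ⊕ (ℕcon 1 ⊕ (n ⊕ n)) ⊜ ℕcon 1 ⊕ n ⊛ ℕcon 3) ≡.refl n))) x^N≈1) ⟩
    - 1# * (1# + 1#) ^ n * 1#
      ≈⟨ *-identityʳ _ ⟩
    - 1# * (1# + 1#) ^ n ∎
    where
    x+1≈-2x : x + 1# ≈ - 1# * (1# + 1#) * x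
    x+1≈-2x = begin
      x + 1#            ≈⟨ +-congˡ (⁻¹-involutive 1#) ⟨
      x - - 1#          ≈⟨ +-congˡ (-‿cong 3x≈-1) ⟨
      x - (x + x + x)   ≈⟨ solve 1 (λ x → x :- (x :+ x :+ x) := :- con (+ 1) :* (con (+ 1) :+ con (+ 1)) :* x) refl x ⟩
      - 1# * (1# + 1#) * x ∎

  -- 1 = 3(n + 1) - (3n + 2), and 3n + 2 will be the order q of the field.
  3≉0 : ∀ n → suc (suc (n ℕ.* 3)) · 1# ≈ 0# → ¬ (1# ≈ 0#) → ¬ (1# + 1# + 1# ≈ 0#)
  3≉0 n q≈0 1≉0 3≈0 = 1≉0 (begin
    1#
      ≈⟨ solve 1 (λ y → con (+ 1) := (con (+ 1) :+ con (+ 1) :+ con (+ 1)) :* (con (+ 1) :+ y) :- (con (+ 1) :+ (con (+ 1) :+ y :* (con (+ 1) :+ (con (+ 1) :+ (con (+ 1) :+ con (+ 0))))))) refl (n · 1#) ⟩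
    (1# + 1# + 1#) * (1# + n · 1#) - (1# + (1# + n · 1# * (3 · 1#)))
      ≈⟨ +-cong (*-congʳ 3≈0) (-‿cong (+-congˡ (+-congˡ (sym (×1-homo-* n 3))))) ⟩
    0# * (1# + n · 1#) - suc (suc (n ℕ.* 3)) · 1#
      ≈⟨ +-cong (zeroˡ _) (-‿cong q≈0) ⟩
    0# - 0#
      ≈⟨ -‿inverseʳ 0# ⟩
    0# ∎)

  quad : Carrier → Carrier → Carrier
  quad x y = x ^ 2 - x * y + y ^ 2

  -- With p = x ^ m, one summand of the recurrence for h; the shape `_ + - 1# * _` is the one that
  -- `sum-linear` adds up.
  quad-recurrence : ∀ {x u} p → quad 1# x * u ≈ 1# → p ≈ (x * (x * p) * u + p * u) + - 1# * (x * p * u)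
  quad-recurrence {x} {u} p qu≈1 = begin
    p
      ≈⟨ *-identityʳ p ⟨
    p * 1#
      ≈⟨ *-congˡ qu≈1 ⟨
    p * (quad 1# x * u)
      ≈⟨ solve 3 (λ x u p → p :* ((con (+ 1) :* (con (+ 1) :* con (+ 1)) :- con (+ 1) :* x :+ x :* (x :* con (+ 1))) :* u)
           := (x :* (x :* p) :* u :+ p :* u) :+ :- con (+ 1) :* (x :* p :* u)) refl x u p ⟩
    (x * (x * p) * u + p * u) + - 1# * (x * p * u) ∎

  -- `quad` is homogeneous of degree 2, so x comes out squared; its inverse y * y is the source of
  -- the row factor D.
  quad-scale : ∀ {x y t u} → x * y ≈ 1# → quad 1# t * u ≈ 1# → quad x (x * t) * (y * y * u) ≈ 1#
  quad-scale {x} {y} {t} {u} xy≈1 qu≈1 = begin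
    quad x (x * t) * (y * y * u)
      ≈⟨ solve 4 (λ x y t u → (x :* (x :* con (+ 1)) :- x :* (x :* t) :+ (x :* t) :* ((x :* t) :* con (+ 1))) :* (y :* y :* u)
           := (x :* y) :* (x :* y) :* ((con (+ 1) :* (con (+ 1) :* con (+ 1)) :- con (+ 1) :* t :+ t :* (t :* con (+ 1))) :* u))
           refl x y t u ⟩
    (x * y) * (x * y) * (quad 1# t * u)
      ≈⟨ *-cong (*-cong xy≈1 xy≈1) qu≈1 ⟩
    1# * 1# * 1#
      ≈⟨ trans (*-identityʳ _) (*-identityʳ _) ⟩
    1# ∎

  quad≈0⇒cube≈-1 : ∀ {x} → quad 1# x ≈ 0# → x ^ 3 ≈ - 1#
  quad≈0⇒cube≈-1 {x} q≈0 = begin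
    x ^ 3
      ≈⟨ solve 1 (λ x → x :* (x :* (x :* con (+ 1))) := (x :+ con (+ 1)) :*
           (con (+ 1) :* (con (+ 1) :* con (+ 1)) :- con (+ 1) :* x :+ x :* (x :* con (+ 1))) :- con (+ 1)) refl x ⟩
    (x + 1#) * quad 1# x - 1#
      ≈⟨ +-congʳ (trans (*-congˡ q≈0) (zeroʳ _)) ⟩
    0# - 1#
      ≈⟨ +-identityˡ _ ⟩
    - 1# ∎

  quad-at--1 : ∀ {x} → x ≈ - 1# → quad 1# x ≈ 1# + 1# + 1#
  quad-at--1 {x} x≈-1 = begin
    quad 1# x
      ≈⟨ +-cong (+-congˡ (-‿cong (*-congˡ x≈-1))) (^-congˡ 2 x≈-1) ⟩
    quad 1# (- 1#)
      ≈⟨ solve 0 (con (+ 1) :* (con (+ 1) :* con (+ 1)) :- con (+ 1) :* :- con (+ 1) :+ :- con (+ 1) :* (:- con (+ 1) :* con (+ 1)) := con (+ 1) :+ con (+ 1) :+ con (+ 1)) refl ⟩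
    1# + 1# + 1# ∎

  -- The recurrences of the eigenvalues: with h m the sums of t ^ m / (t² - t + 1),
  -- the power sums s m are h (m + 2) - h (m + 1) + h m.
  module Recurrence (h s : ℕ → Carrier)
    (rec : ∀ m → s m ≈ (h (2 ℕ.+ m) + h m) + - 1# * h (1 ℕ.+ m)) where

    -- Reflects (t + 1)(t² - t + 1) = t³ + 1: adding two consecutive recurrences cancels the middle
    -- terms.
    rec₃ : ∀ m → h (3 ℕ.+ m) ≈ s (1 ℕ.+ m) + s m - h m
    rec₃ m = begin
      h (3 ℕ.+ m)
        ≈⟨ solve 4 (λ h₀ h₁ h₂ h₃ → h₃ := ((h₃ :+ h₁) :+ :- con (+ 1) :* h₂) :+ ((h₂ :+ h₀) :+ :- con (+ 1) :* h₁) :- h₀)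
             refl (h m) (h (1 ℕ.+ m)) (h (2 ℕ.+ m)) (h (3 ℕ.+ m)) ⟩
      ((h (3 ℕ.+ m) + h (1 ℕ.+ m)) + - 1# * h (2 ℕ.+ m)) + ((h (2 ℕ.+ m) + h m) + - 1# * h (1 ℕ.+ m)) - h m
        ≈⟨ +-congʳ (+-cong (rec (1 ℕ.+ m)) (rec m)) ⟨
      s (1 ℕ.+ m) + s m - h m ∎

    flip : ∀ m j {x} → s (1 ℕ.+ m) ≈ 0# → s m ≈ 0# → h m ≈ ε j * x → h (3 ℕ.+ m) ≈ ε (suc j) * x
    flip m j {x} s₁≈0 s₀≈0 h≈ = begin
      h (3 ℕ.+ m)                 ≈⟨ rec₃ m ⟩
      s (1 ℕ.+ m) + s m - h m     ≈⟨ +-cong (+-cong s₁≈0 s₀≈0) (-‿cong h≈) ⟩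
      0# + 0# - ε j * x           ≈⟨ solve 2 (λ e x → con (+ 0) :+ con (+ 0) :- e :* x := :- con (+ 1) :* e :* x) refl _ _ ⟩
      ε (suc j) * x               ∎

    -- `first` and `jump` are the two exceptional steps: at m = 0 the value x turns into x + 1, and
    -- at m = 3n it returns to x. The return relies on the sign being -1 there, that is, on n being
    -- odd.
    first : s 1 ≈ 0# → s 0 ≈ - 1# → h 3 ≈ ε 1 * (h 0 + 1#)
    first s₁≈0 s₀≈-1 = begin
      h 3                     ≈⟨ rec₃ 0 ⟩
      s 1 + s 0 - h 0         ≈⟨ +-congʳ (+-cong s₁≈0 s₀≈-1) ⟩
      0# + - 1# - h 0         ≈⟨ solve 1 (λ x → con (+ 0) :+ :- con (+ 1) :- x := :- con (+ 1) :* con (+ 1) :* (x :+ con (+ 1))) refl _ ⟩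
      ε 1 * (h 0 + 1#)        ∎

    jump : ∀ m j {x} → s (1 ℕ.+ m) ≈ - 1# → s m ≈ 0# → ε j ≈ - 1# → h m ≈ ε j * (x + 1#) → h (3 ℕ.+ m) ≈ ε (suc j) * x
    jump m j {x} s₁≈-1 s₀≈0 εj≈-1 h≈ = begin
      h (3 ℕ.+ m)                     ≈⟨ rec₃ m ⟩
      s (1 ℕ.+ m) + s m - h m         ≈⟨ +-cong (+-cong s₁≈-1 s₀≈0) (-‿cong (trans h≈ (*-congʳ εj≈-1))) ⟩
      - 1# + 0# - - 1# * (x + 1#)     ≈⟨ solve 1 (λ x → :- con (+ 1) :+ con (+ 0) :- :- con (+ 1) :* (x :+ con (+ 1)) := :- con (+ 1) :* :- con (+ 1) :* x) refl x ⟩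
      - 1# * - 1# * x                 ≈⟨ *-congʳ (*-congˡ εj≈-1) ⟨
      ε (suc j) * x                   ∎

    3h₀≈-1 : s 0 ≈ - 1# → h 2 ≈ h 0 → h 1 ≈ - 1# * h 0 → h 0 + h 0 + h 0 ≈ - 1#
    3h₀≈-1 s₀≈-1 h₂≈h₀ h₁≈-h₀ = begin
      h 0 + h 0 + h 0                       ≈⟨ solve 1 (λ x → x :+ x :+ x := (x :+ x) :+ :- con (+ 1) :* (:- con (+ 1) :* x)) refl _ ⟩
      (h 0 + h 0) + - 1# * (- 1# * h 0)     ≈⟨ +-cong (+-congʳ h₂≈h₀) (*-congˡ h₁≈-h₀) ⟨
      (h 2 + h 0) + - 1# * h 1              ≈⟨ rec 0 ⟨
      s 0                                   ≈⟨ s₀≈-1 ⟩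
      - 1#                                  ∎

-- Divisibility by N.

-- 2n + 1 inverts 3 modulo N = 3n + 1, because 3(2n + 1) = 2N + 1.
∣-cancel-3 : ∀ n m → suc (n ℕ.* 3) ∣ m ℕ.* 3 → suc (n ℕ.* 3) ∣ m
∣-cancel-3 n m N∣3m = ∣m+n∣m⇒∣n
  (≡.subst (N ∣_) (ℕsolve 2 (λ m n → (m ⊛ ℕcon 3) ⊛ (ℕcon 1 ⊕ (n ⊕ n)) ⊜ (m ⊛ ℕcon 2) ⊛ (ℕcon 1 ⊕ n ⊛ ℕcon 3) ⊕ m) ≡.refl m n)
    (∣m⇒∣m*n (suc (n ℕ.+ n)) N∣3m))
  (n∣m*n (m ℕ.* 2))
  where N = suc (n ℕ.* 3)

∤-between : ∀ {N m} → 0 ℕ.< m → m ℕ.< N → ¬ (N ∣ m)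
∤-between {m = suc m} _ m<N = >⇒∤ m<N

-- The sum is congruent to s - r and lies strictly between 0 and 2N, so the quotient can only be 1.
∣-cyclic-difference : ∀ {N r s} → r ℕ.< N → s ℕ.< N → N ∣ (N ∸ suc r) ℕ.+ suc s → r ≡ s
∣-cyclic-difference {N} {r} {s} r<N s<N (divides d x≡dN) = helper d x≡dN
  where
  x : ℕ
  x = (N ∸ suc r) ℕ.+ suc s
  x+r≡N+s : x ℕ.+ r ≡ N ℕ.+ s
  x+r≡N+s = ≡.trans
    (ℕsolve 3 (λ y r s → (y ⊕ (ℕcon 1 ⊕ s)) ⊕ r ⊜ (y ⊕ (ℕcon 1 ⊕ r)) ⊕ s) ≡.refl (N ∸ suc r) r s)
    (≡.cong (ℕ._+ s) (ℕ.m∸n+n≡m r<N))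
  helper : ∀ d → x ≡ d ℕ.* N → r ≡ s
  helper zero x≡0 = contradiction (ℕ.m+n≡0⇒n≡0 (N ∸ suc r) x≡0) λ ()
  helper (suc zero) x≡N = ℕ.+-cancelˡ-≡ N r s
    (≡.trans (≡.cong (ℕ._+ r) (≡.sym (≡.trans x≡N (ℕ.+-identityʳ N)))) x+r≡N+s)
  helper (suc (suc d)) x≡2N+ = contradiction 2N≤N+s (ℕ.<⇒≱ (ℕ.+-monoʳ-< N s<N))
    where
    open ℕ.≤-Reasoning
    2N≤N+s : N ℕ.+ N ℕ.≤ N ℕ.+ s
    2N≤N+s = begin
      N ℕ.+ N                   ≤⟨ ℕ.+-monoʳ-≤ N (ℕ.m≤m+n N (d ℕ.* N)) ⟩
      N ℕ.+ (N ℕ.+ d ℕ.* N)     ≡⟨ x≡2N+ ⟨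
      x                         ≤⟨ ℕ.m≤m+n x r ⟩
      x ℕ.+ r                   ≡⟨ x+r≡N+s ⟩
      N ℕ.+ s                   ∎

-- Integer images lie in the prime field.

module PrimeFieldLemmas {c ℓ₁ ℓ₂ N} (F : FiniteField c ℓ₁ ℓ₂ (suc N))
  {p} (char : HasCharacteristic (FiniteField.commutativeRing F) p) where
  open FiniteField F using (commutativeRing)
  open CommutativeRing commutativeRing hiding (zero)
  open FiniteFieldLemmas F using (q·1≈0)
  open RingLemmas commutativeRing using (image)
  open import Algebra.Properties.AbelianGroup +-abelianGroup using (inverseʳ-unique)
  open import Algebra.Properties.Ring ring using (-1*x≈-x)
  open import Algebra.Properties.Semiring.Mult semiring using (×1-homo-*; ×-homo-+) renaming (_×_ to _·_)
  open import Relation.Binary.Reasoning.Setoid setoid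

  private
    instance
      -- `p` divides the order of the field, which rules out the convention p = 0 and allows
      -- reduction modulo `p`.
      p-nonZero : ℕ.NonZero p
      p-nonZero = ℕ.≢-nonZero λ p≡0 → contradiction
        (0∣⇒≡0 (≡.subst (_∣ suc N) p≡0 (Equivalence.to (char (suc N)) q·1≈0))) λ ()

  inPrimeField-· : ∀ n → InPrimeField commutativeRing p (n · 1#)
  inPrimeField-· n = n % p , ℕ.m%n<n n p , (begin
    n · 1#                                          ≡⟨ ≡.cong (_· 1#) (ℕ.m≡m%n+[m/n]*n n p) ⟩
    (n % p ℕ.+ n / p ℕ.* p) · 1#                    ≈⟨ ×-homo-+ 1# (n % p) (n / p ℕ.* p) ⟩
    (n % p) · 1# + (n / p ℕ.* p) · 1#               ≈⟨ +-congˡ (Equivalence.from (char (n / p ℕ.* p)) (n∣m*n (n / p))) ⟩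
    (n % p) · 1# + 0#                               ≈⟨ +-identityʳ _ ⟩
    (n % p) · 1#                                    ∎)

  -- Since N · 1# ≈ - 1#, negation is multiplication by N.
  inPrimeField-image : ∀ i {x} → x ≈ image i → InPrimeField commutativeRing p x
  inPrimeField-image (+ n)    x≈n  =
    let k , k<p , n≈k = inPrimeField-· n in k , k<p , trans x≈n n≈k
  inPrimeField-image -[1+ n ] x≈-n =
    let k , k<p , Nn≈k = inPrimeField-· (N ℕ.* suc n) in k , k<p , trans x≈-n (trans -n≈Nn Nn≈k)
    where
    -n≈Nn : - (suc n · 1#) ≈ (N ℕ.* suc n) · 1#
    -n≈Nn = begin
      - (suc n · 1#)           ≈⟨ -1*x≈-x _ ⟨
      - 1# * (suc n · 1#)      ≈⟨ *-congʳ (inverseʳ-unique _ _ q·1≈0) ⟨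
      N · 1# * (suc n · 1#)    ≈⟨ ×1-homo-* N (suc n) ⟨
      (N ℕ.* suc n) · 1#       ∎

-- The eigenvalues and their product.

-- `n` and `N` stay variables tied by equations, so that sums and determinants of size `N` do not
-- unfold.
module Evaluation {c ℓ₁ ℓ₂ k n N} (n≡ : n ≡ suc (k ℕ.* 2)) (N≡ : N ≡ suc (n ℕ.* 3))
  (F : FiniteField c ℓ₁ ℓ₂ (suc N)) {a : Vector (FiniteField.Carrier F) N}
  (a-enum : FiniteField.EnumeratesNonzero F a) where

  open FiniteField F using (commutativeRing; _⁻¹; ⁻¹-inverseʳ; T)
  open CommutativeRing commutativeRing hiding (zero)
  open FiniteFieldLemmas F
  open NonzeroElements a-enum
  open DeterminantLemmas commutativeRing using (_⊗_; det-⊗; det-cong; det-diagonal; sum-linear)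
  open DiagonalLemmas commutativeRing
  open EvaluationIdentities commutativeRing
  open import Algebra.Properties.Semiring.Exp semiring using (_^_; ^-congˡ; ^-homo-*; ^-assocʳ)
  open import Algebra.Properties.CommutativeSemiring.Exp commutativeSemiring using (^-distrib-*)
  open import Algebra.Properties.CommutativeSemigroup *-commutativeSemigroup using (interchange)
  open import Algebra.Properties.Semiring.Sum semiring
  open import Algebra.Properties.CommutativeMonoid.Sum *-commutativeMonoid using ()
    renaming (sum to prod)
  open import Relation.Binary.Reasoning.Setoid setoid

  private
    det : ∀ {n} → Matrix commutativeRing n n → Carrier
    det = determinant commutativeRing

    instance
      N-nonZero : ℕ.NonZero N
      N-nonZero = ℕ.≢-nonZero λ N≡0 → contradiction (≡.trans (≡.sym N≡) N≡0) λ ()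

    N≡n+[1+n+n] : N ≡ n ℕ.+ suc (n ℕ.+ n)
    N≡n+[1+n+n] = ≡.trans N≡ (ℕsolve 1 (λ n → ℕcon 1 ⊕ n ⊛ ℕcon 3 ⊜ n ⊕ (ℕcon 1 ⊕ (n ⊕ n))) ≡.refl n)

    εn≈-1 : ε n ≈ - 1#
    εn≈-1 = trans (reflexive (≡.cong ε n≡)) (ε-odd k)

    ε[1+n]≈1 : ε (suc n) ≈ 1#
    ε[1+n]≈1 = trans (reflexive (≡.cong (ε ∘ suc) n≡)) (ε-even (suc k))

    ε[1+n+n]≈-1 : ε (suc (n ℕ.+ n)) ≈ - 1#
    ε[1+n+n]≈-1 = begin
      - 1# * ε (n ℕ.+ n)     ≈⟨ *-congˡ (^-homo-* (- 1#) n n) ⟩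
      - 1# * (ε n * ε n)     ≈⟨ *-assoc _ _ _ ⟨
      ε (suc n) * ε n        ≈⟨ *-cong ε[1+n]≈1 εn≈-1 ⟩
      1# * - 1#              ≈⟨ *-identityˡ _ ⟩
      - 1#                   ∎

  N∣3m⇒N∣m : ∀ m → N ∣ m ℕ.* 3 → N ∣ m
  N∣3m⇒N∣m m = ≡.subst (λ N → N ∣ m ℕ.* 3 → N ∣ m) (≡.sym N≡) (∣-cancel-3 n m)

  -- A root has x³ = -1. Since 2N + 1 = 3(2n + 1), Fermat gives x = (x³) ^ (2n + 1) = -1, where the
  -- polynomial takes the nonzero value 3.
  quad≉0 : ∀ {x} → ¬ (x ≈ 0#) → ¬ (quad 1# x ≈ 0#)
  quad≉0 {x} x≉0 q≈0 = 3≉0 n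
    (trans (reflexive (≡.cong (λ N → suc N · 1#) (≡.sym N≡))) q·1≈0) 1≉0
    (trans (sym (quad-at--1 x≈-1)) q≈0)
    where
    open import Algebra.Properties.Semiring.Mult semiring using () renaming (_×_ to _·_)
    x≈-1 : x ≈ - 1#
    x≈-1 = begin
      x                            ≈⟨ *-identityʳ x ⟨
      x ^ 1                        ≈⟨ ^-period-* 2 1 x≉0 ⟨
      x ^ (1 ℕ.+ 2 ℕ.* N)          ≡⟨ ≡.cong (x ^_) (≡.trans (≡.cong (λ N → 1 ℕ.+ 2 ℕ.* N) N≡)
        (ℕsolve 1 (λ n → ℕcon 1 ⊕ ℕcon 2 ⊛ (ℕcon 1 ⊕ n ⊛ ℕcon 3) ⊜ ℕcon 3 ⊛ (ℕcon 1 ⊕ (n ⊕ n))) ≡.refl n)) ⟩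
      x ^ (3 ℕ.* suc (n ℕ.+ n))    ≈⟨ ^-assocʳ x 3 (suc (n ℕ.+ n)) ⟨
      (x ^ 3) ^ suc (n ℕ.+ n)      ≈⟨ ^-congˡ (suc (n ℕ.+ n)) (quad≈0⇒cube≈-1 q≈0) ⟩
      ε (suc (n ℕ.+ n))            ≈⟨ ε[1+n+n]≈-1 ⟩
      - 1#                         ∎

  weight : Fin N → Carrier
  weight i = quad 1# (a i) ⁻¹

  -- The h of the overview, with `powerSum` as its s and `weightedSum 0` as its x.
  weightedSum : ℕ → Carrier
  weightedSum m = sum λ i → a i ^ m * weight i

  weightedSum-recurrence : ∀ m →
    powerSum m ≈ (weightedSum (2 ℕ.+ m) + weightedSum m) + - 1# * weightedSum (1 ℕ.+ m)
  weightedSum-recurrence m = begin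
    powerSum m
      ≈⟨ sum-linear (- 1#) _ _ _ (λ i → quad-recurrence (a i ^ m) (⁻¹-inverseʳ (quad≉0 (a≉0 i)))) ⟩
    sum (λ i → a i ^ (2 ℕ.+ m) * weight i + a i ^ m * weight i) + - 1# * weightedSum (1 ℕ.+ m)
      ≈⟨ +-congʳ (∑-distrib-+ (λ i → a i ^ (2 ℕ.+ m) * weight i) (λ i → a i ^ m * weight i)) ⟩
    (weightedSum (2 ℕ.+ m) + weightedSum m) + - 1# * weightedSum (1 ℕ.+ m) ∎

  open Recurrence weightedSum powerSum weightedSum-recurrence

  weightedSum-period : ∀ m → weightedSum (N ℕ.+ m) ≈ weightedSum m
  weightedSum-period m = sum-cong-≋ λ i → *-congʳ (^-period m (a≉0 i))

  n<N : n ℕ.< N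
  n<N = ≡.subst (n ℕ.<_) (≡.sym N≡n+[1+n+n]) (ℕ.m<m+n n (s≤s z≤n))

  1+3j<N : ∀ {j} → j ℕ.< n → suc (j ℕ.* 3) ℕ.< N
  1+3j<N {j} j<n = ≡.subst (suc (j ℕ.* 3) ℕ.<_) (≡.sym N≡) (s≤s (ℕ.*-monoˡ-< 3 j<n))

  -- The power sums occurring in the step from t ^ 3j to t ^ 3(j+1) vanish
  -- unless j = 0 or 3j + 1 = N, that is j = n.
  powerSum-3j : ∀ {j} → 0 ℕ.< j → j ℕ.< N → powerSum (j ℕ.* 3) ≈ 0#
  powerSum-3j {j} 0<j j<N = powerSum-∤ (∤-between 0<j j<N ∘ N∣3m⇒N∣m j)

  powerSum-1+3j : ∀ {j} → j ℕ.< n → powerSum (suc (j ℕ.* 3)) ≈ 0#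
  powerSum-1+3j j<n = powerSum-∤ (∤-between (s≤s z≤n) (1+3j<N j<n))

  -- The exponent is N + 3(j + 1), so N dividing it would divide j + 1, which is positive and less
  -- than N.
  powerSum-1+3[n+1+j] : ∀ {j} → n ℕ.+ suc j ℕ.< N → powerSum (suc ((n ℕ.+ suc j) ℕ.* 3)) ≈ 0#
  powerSum-1+3[n+1+j] {j} n+1+j<N = powerSum-∤ λ N∣ →
    ∤-between (s≤s z≤n) (ℕ.≤-<-trans (ℕ.m≤n+m (suc j) n) n+1+j<N) (N∣3m⇒N∣m (suc j)
      (∣m+n∣m⇒∣n (≡.subst (N ∣_) (≡.trans (≡.cong suc (ℕ.*-distribʳ-+ 3 n (suc j)))
        (≡.cong (ℕ._+ suc j ℕ.* 3) (≡.sym N≡))) N∣) ∣-refl))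

  powerSum-0 : powerSum 0 ≈ - 1#
  powerSum-0 = powerSum-∣ ≡.refl (N ∣0)

  powerSum-1+3n : powerSum (suc (n ℕ.* 3)) ≈ - 1#
  powerSum-1+3n = powerSum-∣ ≡.refl (≡.subst (N ∣_) N≡ ∣-refl)

  -- Counted from 0 to match `Fin N`: index j stands for r = j + 1.
  eigenvalue : ℕ → Carrier
  eigenvalue j = weightedSum (suc j ℕ.* 3)

  eigenvalue-<n : ∀ j → j ℕ.< n → eigenvalue j ≈ ε (suc j) * (weightedSum 0 + 1#)
  eigenvalue-<n zero    0<n   = first (powerSum-1+3j 0<n) powerSum-0
  eigenvalue-<n (suc j) 1+j<n = flip (suc j ℕ.* 3) (suc j)
    (powerSum-1+3j 1+j<n) (powerSum-3j (s≤s z≤n) (ℕ.<-trans 1+j<n n<N))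
    (eigenvalue-<n j (ℕ.<-trans (ℕ.n<1+n j) 1+j<n))

  0<n : 0 ℕ.< n
  0<n = ≡.subst (0 ℕ.<_) (≡.sym n≡) (s≤s z≤n)

  weightedSum-3n : weightedSum (n ℕ.* 3) ≈ ε n * (weightedSum 0 + 1#)
  weightedSum-3n = ≡.subst (λ m → weightedSum (m ℕ.* 3) ≈ ε m * (weightedSum 0 + 1#)) (≡.sym n≡)
    (eigenvalue-<n (k ℕ.* 2) (≡.subst (k ℕ.* 2 ℕ.<_) (≡.sym n≡) (ℕ.n<1+n _)))

  eigenvalue-≥n : ∀ j → j ℕ.< suc (n ℕ.+ n) → eigenvalue (n ℕ.+ j) ≈ ε (suc (n ℕ.+ j)) * weightedSum 0
  -- The step from exponent 3n, which meets the power sum of exponent 3n + 1 = N.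
  eigenvalue-≥n zero _ = ≡.subst (λ m → eigenvalue m ≈ ε (suc m) * weightedSum 0) (≡.sym (ℕ.+-identityʳ n))
    (jump (n ℕ.* 3) n powerSum-1+3n (powerSum-3j 0<n n<N) εn≈-1 weightedSum-3n)
  eigenvalue-≥n (suc j) 1+j<1+n+n = flip ((n ℕ.+ suc j) ℕ.* 3) (n ℕ.+ suc j)
    (powerSum-1+3[n+1+j] n+1+j<N)
    (powerSum-3j (ℕ.<-≤-trans 0<n (ℕ.m≤m+n n (suc j))) n+1+j<N)
    (≡.subst (λ m → weightedSum (m ℕ.* 3) ≈ ε m * weightedSum 0) (≡.sym (ℕ.+-suc n j))
      (eigenvalue-≥n j (ℕ.<-trans (ℕ.n<1+n j) 1+j<1+n+n)))
    where
    n+1+j<N : n ℕ.+ suc j ℕ.< N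
    n+1+j<N = ≡.subst (_ ℕ.<_) (≡.sym N≡n+[1+n+n]) (ℕ.+-monoʳ-< n 1+j<1+n+n)

  -- 2 ≡ 3(n + 1) and 1 ≡ 3(2n + 1) modulo N.
  3*weightedSum-0 : weightedSum 0 + weightedSum 0 + weightedSum 0 ≈ - 1#
  3*weightedSum-0 = 3h₀≈-1 powerSum-0
    (begin
      weightedSum 2                        ≈⟨ weightedSum-period 2 ⟨
      weightedSum (N ℕ.+ 2)                ≡⟨ ≡.cong weightedSum (≡.trans (≡.cong (ℕ._+ 2) N≡)
        (ℕsolve 1 (λ n → ℕcon 1 ⊕ n ⊛ ℕcon 3 ⊕ ℕcon 2 ⊜ (ℕcon 1 ⊕ (n ⊕ ℕcon 0)) ⊛ ℕcon 3) ≡.refl n)) ⟩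
      eigenvalue (n ℕ.+ 0)                 ≈⟨ eigenvalue-≥n 0 (s≤s z≤n) ⟩
      ε (suc (n ℕ.+ 0)) * weightedSum 0    ≡⟨ ≡.cong (λ m → ε (suc m) * weightedSum 0) (ℕ.+-identityʳ n) ⟩
      ε (suc n) * weightedSum 0            ≈⟨ *-congʳ ε[1+n]≈1 ⟩
      1# * weightedSum 0                   ≈⟨ *-identityˡ _ ⟩
      weightedSum 0                        ∎)
    (begin
      weightedSum 1                        ≈⟨ weightedSum-period 1 ⟨
      weightedSum (N ℕ.+ 1)                ≈⟨ weightedSum-period (N ℕ.+ 1) ⟨
      weightedSum (N ℕ.+ (N ℕ.+ 1))        ≡⟨ ≡.cong weightedSum (≡.trans (≡.cong (λ N → N ℕ.+ (N ℕ.+ 1)) N≡)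
        (ℕsolve 1 (λ n → (ℕcon 1 ⊕ n ⊛ ℕcon 3) ⊕ ((ℕcon 1 ⊕ n ⊛ ℕcon 3) ⊕ ℕcon 1) ⊜ (ℕcon 1 ⊕ (n ⊕ n)) ⊛ ℕcon 3) ≡.refl n)) ⟩
      eigenvalue (n ℕ.+ n)                 ≈⟨ eigenvalue-≥n n (ℕ.m<n+m n (s≤s z≤n)) ⟩
      ε (suc (n ℕ.+ n)) * weightedSum 0    ≈⟨ *-congʳ ε[1+n+n]≈-1 ⟩
      - 1# * weightedSum 0                 ∎)

  -- Allows `fermat` to be applied to x.
  weightedSum-0≉0 : ¬ (weightedSum 0 ≈ 0#)
  weightedSum-0≉0 x≈0 = 1≉0 (begin
    1#                                                     ≈⟨ ε-even 1 ⟨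
    - 1# * (- 1# * 1#)                                     ≈⟨ *-congˡ (*-identityʳ _) ⟩
    - 1# * - 1#                                            ≈⟨ *-congˡ 3*weightedSum-0 ⟨
    - 1# * (weightedSum 0 + weightedSum 0 + weightedSum 0) ≈⟨ *-congˡ (+-cong (+-cong x≈0 x≈0) x≈0) ⟩
    - 1# * (0# + 0# + 0#)                                  ≈⟨ *-congˡ (trans (+-identityʳ _) (+-identityʳ _)) ⟩
    - 1# * 0#                                              ≈⟨ zeroʳ _ ⟩
    0#                                                     ∎)

  -- The alternating signs contribute (-1)^h and the factors (x + 1)^n x^(2n + 1) contribute -2^n;
  -- the extra minus sign raises the exponent to h + 1.
  prod-eigenvalues : ∀ h → N ≡ h ℕ.* 2 →
    prod {N} (eigenvalue ∘ toℕ) ≈ ε (suc h) * (1# + 1#) ^ n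
  prod-eigenvalues h N≡2h = begin
    prod {N} (eigenvalue ∘ toℕ)
      ≡⟨ ≡.cong (λ N → prod {N} (eigenvalue ∘ toℕ)) N≡n+[1+n+n] ⟩
    prod {n ℕ.+ suc (n ℕ.+ n)} (eigenvalue ∘ toℕ)
      ≈⟨ prod-scaled-++ n (suc (n ℕ.+ n)) (weightedSum 0 + 1#) (weightedSum 0) eigenvalue (ε ∘ suc) eigenvalue-<n eigenvalue-≥n ⟩
    prod {n ℕ.+ suc (n ℕ.+ n)} (ε ∘ suc ∘ toℕ) * ((weightedSum 0 + 1#) ^ n * weightedSum 0 ^ suc (n ℕ.+ n))
      ≈⟨ *-cong (reflexive (≡.cong (λ N → prod {N} (ε ∘ suc ∘ toℕ)) (≡.trans (≡.sym N≡n+[1+n+n]) N≡2h)))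
           (power-evaluation n (weightedSum 0) εn≈-1 3*weightedSum-0
             (trans (reflexive (≡.cong (weightedSum 0 ^_) (≡.sym N≡))) (fermat weightedSum-0≉0))) ⟩
    prod {h ℕ.* 2} (ε ∘ suc ∘ toℕ) * (- 1# * (1# + 1#) ^ n)
      ≈⟨ *-congʳ (prod-ε h) ⟩
    ε h * (- 1# * (1# + 1#) ^ n)
      ≈⟨ *-assoc _ _ _ ⟨
    ε h * - 1# * (1# + 1#) ^ n
      ≈⟨ *-congʳ (*-comm _ _) ⟩
    ε (suc h) * (1# + 1#) ^ n ∎

  -- Diagonalisation of T.

  T-row : ∀ i m → sum (λ j → T a i j * a j ^ m) ≈ (a i ⁻¹ * a i ⁻¹) * (a i ^ m * weightedSum m)
  T-row i m = begin
    sum (λ j → T a i j * a j ^ m)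
      ≈⟨ sum-permute (λ j → T a i j * a j ^ m) (proj₁ π) ⟩
    sum (λ j → T a i (proj₁ π ⟨$⟩ʳ j) * a (proj₁ π ⟨$⟩ʳ j) ^ m)
      ≈⟨ sum-cong-≋ term ⟩
    sum (λ j → (a i ⁻¹ * a i ⁻¹) * a i ^ m * (a j ^ m * weight j))
      ≈⟨ *-distribˡ-sum ((a i ⁻¹ * a i ⁻¹) * a i ^ m) (λ j → a j ^ m * weight j) ⟨
    (a i ⁻¹ * a i ⁻¹) * a i ^ m * weightedSum m
      ≈⟨ *-assoc _ _ _ ⟩
    (a i ⁻¹ * a i ⁻¹) * (a i ^ m * weightedSum m) ∎
    where
    π = scaling (a≉0 i)
    term : ∀ j → T a i (proj₁ π ⟨$⟩ʳ j) * a (proj₁ π ⟨$⟩ʳ j) ^ m ≈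
                 (a i ⁻¹ * a i ⁻¹) * a i ^ m * (a j ^ m * weight j)
    term j = begin
      quad (a i) (a (proj₁ π ⟨$⟩ʳ j)) ⁻¹ * a (proj₁ π ⟨$⟩ʳ j) ^ m
        ≈⟨ *-cong (⁻¹-cong (+-cong (+-congˡ (-‿cong (*-congˡ (proj₂ π j)))) (^-congˡ 2 (proj₂ π j)))) (^-congˡ m (proj₂ π j)) ⟩
      quad (a i) (a i * a j) ⁻¹ * (a i * a j) ^ m
        ≈⟨ *-cong (⁻¹-unique (quad-scale (⁻¹-inverseʳ (a≉0 i)) (⁻¹-inverseʳ (quad≉0 (a≉0 j))))) (^-distrib-* (a i) (a j) m) ⟩
      (a i ⁻¹ * a i ⁻¹ * weight j) * (a i ^ m * a j ^ m)
        ≈⟨ interchange _ _ _ _ ⟩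
      (a i ⁻¹ * a i ⁻¹ * a i ^ m) * (weight j * a j ^ m)
        ≈⟨ *-congˡ (*-comm _ _) ⟩
      (a i ⁻¹ * a i ⁻¹) * a i ^ m * (a j ^ m * weight j) ∎

  -- A Fourier matrix of the multiplicative group and its conjugate: N - r represents -r modulo N,
  -- so orthogonality of characters makes `W ⊗ V` minus the identity.
  V W : Matrix commutativeRing N N
  V i r = a i ^ (suc (toℕ r) ℕ.* 3)
  W r i = a i ^ ((N ∸ suc (toℕ r)) ℕ.* 3)

  W⊗V : ∀ r s → (W ⊗ V) r s ≈ powerSum (((N ∸ suc (toℕ r)) ℕ.+ suc (toℕ s)) ℕ.* 3)
  W⊗V r s = sum-cong-≋ λ i → trans
    (sym (^-homo-* (a i) ((N ∸ suc (toℕ r)) ℕ.* 3) (suc (toℕ s) ℕ.* 3)))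
    (reflexive (≡.cong (a i ^_) (≡.sym (ℕ.*-distribʳ-+ 3 (N ∸ suc (toℕ r)) (suc (toℕ s))))))

  det-V≉0 : ¬ (det V ≈ 0#)
  det-V≉0 det-V≈0 = prod-≉0 (λ i → (W ⊗ V) i i) diagonal≉0 (begin
    prod (λ i → (W ⊗ V) i i)    ≈⟨ det-diagonal (W ⊗ V) off-diagonal ⟨
    det (W ⊗ V)                 ≈⟨ det-⊗ W V ⟩
    det W * det V               ≈⟨ trans (*-congˡ det-V≈0) (zeroʳ _) ⟩
    0#                          ∎)
    where
    off-diagonal : ∀ r s → r ≢ s → (W ⊗ V) r s ≈ 0#
    off-diagonal r s r≢s = trans (W⊗V r s) (powerSum-∤ λ N∣ → r≢s (Fin.toℕ-injective
      (∣-cyclic-difference (Fin.toℕ<n r) (Fin.toℕ<n s) (N∣3m⇒N∣m _ N∣))))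
    diagonal≉0 : ∀ r → ¬ ((W ⊗ V) r r ≈ 0#)
    diagonal≉0 r ≈0 = 1≉0 (begin
      1#                     ≈⟨ ε-even 1 ⟨
      - 1# * (- 1# * 1#)     ≈⟨ *-congˡ (*-identityʳ _) ⟩
      - 1# * - 1#            ≈⟨ *-congˡ (trans (sym (trans (W⊗V r r) (powerSum-∣ ≡.refl
        (∣m⇒∣m*n 3 (≡.subst (N ∣_) (≡.sym (ℕ.m∸n+n≡m (Fin.toℕ<n r))) ∣-refl))))) ≈0) ⟩
      - 1# * 0#              ≈⟨ zeroʳ _ ⟩
      0#                     ∎)

  det-T : det (T a) ≈ prod {N} (eigenvalue ∘ toℕ)
  det-T = *-cancelˡ det-V≉0 (begin
    det V * det (T a)
      ≈⟨ *-comm _ _ ⟩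
    det (T a) * det V
      ≈⟨ det-⊗ (T a) V ⟨
    det (T a ⊗ V)
      ≈⟨ det-cong (λ i r → T-row i (suc (toℕ r) ℕ.* 3)) ⟩
    det (λ i r → (a i ⁻¹ * a i ⁻¹) * (V i r * eigenvalue (toℕ r)))
      ≈⟨ det-scaleRows (λ i → a i ⁻¹ * a i ⁻¹) (λ i r → V i r * eigenvalue (toℕ r)) ⟩
    prod (λ i → a i ⁻¹ * a i ⁻¹) * det (λ i r → V i r * eigenvalue (toℕ r))
      ≈⟨ *-cong inverse-square-prod (det-scaleColumns (eigenvalue ∘ toℕ) V) ⟩
    1# * (det V * prod {N} (eigenvalue ∘ toℕ))
      ≈⟨ *-identityˡ _ ⟩
    det V * prod {N} (eigenvalue ∘ toℕ) ∎)

  det-T-value : det (T a) ≈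
    integerImage commutativeRing (-1ℤ ℤ.^ ((suc N ℕ.+ 1) / 2) ℤ.* (+ 2) ℤ.^ ((N ∸ 1) / 3))
  det-T-value = begin
    det (T a)                            ≈⟨ det-T ⟩
    prod {N} (eigenvalue ∘ toℕ)          ≈⟨ prod-eigenvalues h N≡2h ⟩
    ε (suc h) * (1# + 1#) ^ n            ≡⟨ ≡.cong₂ (λ x y → ε x * (1# + 1#) ^ y) [N+2]/2≡1+h [N-1]/3≡n ⟨
    ε ((suc N ℕ.+ 1) / 2) * (1# + 1#) ^ ((N ∸ 1) / 3)
      ≈⟨ image-±2^ ((suc N ℕ.+ 1) / 2) ((N ∸ 1) / 3) ⟨
    integerImage commutativeRing (-1ℤ ℤ.^ ((suc N ℕ.+ 1) / 2) ℤ.* (+ 2) ℤ.^ ((N ∸ 1) / 3)) ∎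
    where
    h : ℕ
    -- Half of N = 3(2k + 1) + 1 = 6k + 4.
    h = suc (suc (k ℕ.* 3))
    N≡2h : N ≡ h ℕ.* 2
    N≡2h = ≡.trans N≡ (≡.trans (≡.cong (λ n → suc (n ℕ.* 3)) n≡)
      (ℕsolve 1 (λ k → ℕcon 1 ⊕ (ℕcon 1 ⊕ k ⊛ ℕcon 2) ⊛ ℕcon 3 ⊜ (ℕcon 2 ⊕ k ⊛ ℕcon 3) ⊛ ℕcon 2) ≡.refl k))
    [N+2]/2≡1+h : (suc N ℕ.+ 1) / 2 ≡ suc h
    [N+2]/2≡1+h = ≡.trans
      (≡.cong (_/ 2) (≡.trans (ℕ.+-comm (suc N) 1) (≡.cong (2 ℕ.+_) N≡2h)))
      (ℕ.m*n/n≡m (suc h) 2)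
    [N-1]/3≡n : (N ∸ 1) / 3 ≡ n
    [N-1]/3≡n = ≡.trans (≡.cong (λ N → (N ∸ 1) / 3) N≡) (ℕ.m*n/n≡m n 3)

-- From the hypotheses on q to the evaluation.

-- In q = 3n + 2 an even n would make q even, so n = 2k + 1.
odd-2-mod-3 : ∀ q → ¬ (2 ∣ q) → q % 3 ≡ 2 → ∃[ k ] q ≡ suc (suc (suc (k ℕ.* 2) ℕ.* 3))
odd-2-mod-3 q 2∤q q%3≡2 = helper (n % 2) ≡.refl (ℕ.m%n<n n 2)
  where
  n k : ℕ
  n = q / 3
  k = n / 2
  q≡ : ∀ r → n % 2 ≡ r → q ≡ 2 ℕ.+ (r ℕ.+ k ℕ.* 2) ℕ.* 3
  q≡ r n%2≡r = ≡.trans (ℕ.m≡m%n+[m/n]*n q 3) (≡.cong₂ (λ x y → x ℕ.+ y ℕ.* 3) q%3≡2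
    (≡.trans (ℕ.m≡m%n+[m/n]*n n 2) (≡.cong (ℕ._+ k ℕ.* 2) n%2≡r)))
  helper : ∀ r → n % 2 ≡ r → r ℕ.< 2 → ∃[ k ] q ≡ suc (suc (suc (k ℕ.* 2) ℕ.* 3))
  helper zero          n%2≡0 _ = contradiction (divides (suc (k ℕ.* 3)) (≡.trans (q≡ 0 n%2≡0)
    (ℕsolve 1 (λ k → ℕcon 2 ⊕ (k ⊛ ℕcon 2) ⊛ ℕcon 3 ⊜ (ℕcon 1 ⊕ k ⊛ ℕcon 3) ⊛ ℕcon 2) ≡.refl k))) 2∤q
  helper (suc zero)    n%2≡1 _ = k , q≡ 1 n%2≡1
  helper (suc (suc r)) _ (s≤s (s≤s ()))

-- With `q` a variable, the equation can be matched with `≡.refl`; then `q ∸ 1` and `q ∸ 2` compute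
-- and the types agree with those of `Evaluation`.
det-T-evaluation : ∀ {c ℓ₁ ℓ₂ q} k → q ≡ suc (suc (suc (k ℕ.* 2) ℕ.* 3)) →
    (F : FiniteField c ℓ₁ ℓ₂ q) →
    let open FiniteField F in
    (p : ℕ) → HasCharacteristic commutativeRing p →
    (a : Vector Carrier (q ∸ 1)) → EnumeratesNonzero a →
    determinant commutativeRing (T a)
    ≈ integerImage commutativeRing (-1ℤ ℤ.^ ((q ℕ.+ 1) / 2) ℤ.* (+ 2) ℤ.^ ((q ∸ 2) / 3))
    × InPrimeField commutativeRing p (determinant commutativeRing (T a))
det-T-evaluation {q = q} k ≡.refl F p char a a-enum =
  value , PrimeFieldLemmas.inPrimeField-image F char
    (-1ℤ ℤ.^ ((q ℕ.+ 1) / 2) ℤ.* (+ 2) ℤ.^ ((q ∸ 2) / 3)) value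
  where value = Evaluation.det-T-value {k = k} ≡.refl ≡.refl F a-enum

theorem1 : ∀ {c ℓ₁ ℓ₂} (q : ℕ) → IsPrimePower q → ¬ (2 ∣ q) → q % 3 ≡ 2 →
    (F : FiniteField c ℓ₁ ℓ₂ q) →
    let open FiniteField F in
    (p : ℕ) → HasCharacteristic commutativeRing p →
    (a : Vector Carrier (q ∸ 1)) → EnumeratesNonzero a →
    determinant commutativeRing (T a)
    ≈ integerImage commutativeRing (-1ℤ ℤ.^ ((q ℕ.+ 1) / 2) ℤ.* (+ 2) ℤ.^ ((q ∸ 2) / 3))
    × InPrimeField commutativeRing p (determinant commutativeRing (T a))
theorem1 q _ 2∤q q%3≡2 = det-T-evaluation (proj₁ k,q≡) (proj₂ k,q≡)
  where k,q≡ = odd-2-mod-3 q 2∤q q%3≡2
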